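{- Let $G$ be a finite group of order $n$ with identity $e$, and let $S\subseteq G\setminus\{e\}$ satisfy $S=S^{ -1}$, $G=\langle S\rangle$ and $|S|=2$. Then $\gamma_{S}(\mathrm{Cay}(S:G))=n-4$ if and only if $G$ is isomorphic to one of $\mathbb{Z}_6$, $\mathbb{Z}_7$, $\mathbb{Z}_8$, $S_3$, $D_8$.
   Context: $\mathrm{Cay}(S:G)$ is the simple graph with vertex set $G$ in which $a$ and $b$ are adjacent if and only if $ab^{ -1}\in S$. For a graph $\Gamma$, $N[v]$ denotes the closed neighborhood of $v$ (the vertex $v$ together with all its neighbors). A signed dominating function of $\Gamma$ is a function $g:V(\Gamma)\to\{ -1,1\}$ with $\sum_{u\in N[v]}g(u)>0$ for every $v\in V(\Gamma)$; its weight is $\sum_{v\in V(\Gamma)}g(v)$. The signed domination number $\gamma_{S}(\Gamma)$ is the minimum weight of a signed dominating function of $\Gamma$ (the subscript $S$ in $\gamma_S$ is part of the notation and unrelated to the set $S$). $S_3$ is the symmetric group on three letters and $D_8$ is the dihedral group of order $8$. -}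

module Defs where

open import Algebra.Bundles using (Group)
open import Algebra.Morphism.Structures using (module GroupMorphisms)
import Algebra.Properties.CommutativeMonoid.Sum as CommutativeMonoidSum
import Algebra.Properties.Group as GroupProperties
open import Data.Bool.Base using (if_then_else_)
open import Data.Fin.Base using (Fin)
open import Data.Fin.Permutation as Perm
  using (Permutation′; _⟨$⟩ʳ_; _⟨$⟩ˡ_; _∘ₚ_; flip)
import Data.Fin.Properties as Fin
open import Data.Integer.Base as ℤ using (ℤ; +_; _◃_)
open import Data.Integer.Divisibility.Signed
  using (_∣_; divides; ∣m∣n⇒∣m+n; ∣m⇒∣-m; ∣n⇒∣m*n)
import Data.Integer.Properties as ℤ
open import Data.Integer.Tactic.RingSolver using (solve-∀)
open import Data.Nat.Base using (ℕ)
open import Data.Product.Base using (Σ; _×_; _,_; proj₁; proj₂; ∃; ∃-syntax)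
open import Data.Product.Relation.Binary.Pointwise.NonDependent using (×-setoid)
open import Data.Sign.Base as Sign using (Sign)
import Data.Sign.Properties as Sign
open import Data.Sum.Base using (_⊎_)
open import Function.Bundles using (Func; Inverse)
open import Function.Properties.Inverse using (Inverse⇒Injection)
import Function.Construct.Symmetry as Symmetry
open import Level using (Level; 0ℓ; _⊔_; suc)
open import Relation.Binary.Bundles using (Setoid)
open import Relation.Binary.Core using (Rel)
import Relation.Binary.Construct.On as On
open import Relation.Binary.Definitions
  using (Decidable; Symmetric; _Respects_; _Respects₂_)
open import Relation.Binary.PropositionalEquality as ≡
  using (_≡_; refl; cong; subst)
open import Relation.Nullary using (¬_; Dec; does)
open import Relation.Nullary.Decidable using (map′; _⊎-dec_)
open import Relation.Unary as Unary using (Pred; _∈_; _∉_; _≐_)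

private
  variable
    a c ℓ p r c′ ℓ′ : Level

------------------------------------------------------------------------
-- Finite sets

infix 4 _HasCardinality_

_HasCardinality_ : Setoid a ℓ → ℕ → Set (a ⊔ ℓ)
A HasCardinality n = Inverse (≡.setoid (Fin n)) A

Subsetoid : (A : Setoid a ℓ) → Pred (Setoid.Carrier A) p → Setoid (a ⊔ p) ℓ
Subsetoid A P = On.setoid {B = Σ (Setoid.Carrier A) P} A proj₁

module _ (A : Setoid a ℓ) where
  open Setoid A using (Carrier; _≈_)

  ≈-decidable : ∀ {n} → A HasCardinality n → Decidable _≈_
  ≈-decidable |A|≡n =
    Fin.inj⇒≟ (Inverse⇒Injection (Symmetry.inverse |A|≡n))

  ∈-decidable : ∀ {n m} {P : Pred Carrier p} →
                A HasCardinality n → P Respects _≈_ →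
                Subsetoid A P HasCardinality m → Unary.Decidable P
  ∈-decidable |A|≡n P-resp |P|≡m x =
    map′ (λ (i , eq) → P-resp eq (proj₂ (to i)))
         (λ x∈P → from (x , x∈P) , inverseˡ refl)
         (Fin.any? (λ i → ≈-decidable |A|≡n (proj₁ (to i)) x))
    where open Inverse |P|≡m using (to; from; inverseˡ)

------------------------------------------------------------------------
-- Finite simple graphs and signed domination

record FiniteSimpleGraph (a ℓ r : Level) : Set (suc (a ⊔ ℓ ⊔ r)) where
  field
    vertices  : Setoid a ℓ

  open Setoid vertices public using (_≈_) renaming (Carrier to V)

  field
    Adjacent  : Rel V r
    resp      : Adjacent Respects₂ _≈_
    symmetric : Symmetric Adjacent
    loopless  : ∀ {v} → ¬ Adjacent v v
    adjacent? : Decidable Adjacent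
    order     : ℕ
    finite    : vertices HasCardinality order

  infix 4 _∈N[_] _∈N[_]?

  _∈N[_] : V → V → Set (ℓ ⊔ r)
  u ∈N[ v ] = u ≈ v ⊎ Adjacent u v

  _∈N[_]? : ∀ u v → Dec (u ∈N[ v ])
  u ∈N[ v ]? = ≈-decidable vertices finite u v ⊎-dec adjacent? u v

  -- The value does not depend on the enumeration `finite`, for functions
  -- that respect the equality of vertices.
  ∑ : (V → ℤ) → ℤ
  ∑ f = sum (λ i → f (Inverse.to finite i))
    where open CommutativeMonoidSum ℤ.+-0-commutativeMonoid using (sum)

  ∑N[_] : V → (V → ℤ) → ℤ
  ∑N[ v ] f = ∑ (λ u → if does (u ∈N[ v ]?) then f u else ℤ.0ℤ)

-- The set {-1 , 1} of integers is represented by `Sign`.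
⟦_⟧ : Sign → ℤ
⟦ s ⟧ = s ◃ 1

module _ (Γ : FiniteSimpleGraph a ℓ r) where
  open FiniteSimpleGraph Γ

  Signing : Set (a ⊔ ℓ)
  Signing = Func vertices (≡.setoid Sign)

  weight : Signing → ℤ
  weight g = ∑ (λ v → ⟦ Func.to g v ⟧)

  IsSignedDominating : Signing → Set a
  IsSignedDominating g = ∀ v → ∑N[ v ] (λ u → ⟦ Func.to g u ⟧) ℤ.> ℤ.0ℤ

  -- `SignedDominationNumberIs k` says that γ_S(Γ) = k: the minimum of the
  -- weights of signed dominating functions is attained and equal to k.
  SignedDominationNumberIs : ℤ → Set (a ⊔ ℓ)
  SignedDominationNumberIs k =
    (∃[ g ] IsSignedDominating g × weight g ≡ k) ×
    (∀ g → IsSignedDominating g → k ℤ.≤ weight g)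

------------------------------------------------------------------------
-- Groups and Cayley graphs

infix 4 _≅_

_≅_ : Group c ℓ → Group c′ ℓ′ → Set (c ⊔ ℓ ⊔ c′ ⊔ ℓ′)
G ≅ H = ∃ IsGroupIsomorphism
  where open GroupMorphisms (Group.rawGroup G) (Group.rawGroup H)
          using (IsGroupIsomorphism)

module _ (G : Group c ℓ) where
  open Group G renaming (refl to ≈-refl; sym to ≈-sym; trans to ≈-trans)

  InverseSet : Pred Carrier p → Pred Carrier (c ⊔ ℓ ⊔ p)
  InverseSet S x = ∃[ s ] s ∈ S × x ≈ s ⁻¹

  data Generated (S : Pred Carrier p) : Pred Carrier (c ⊔ ℓ ⊔ p) where
    generator : ∀ {x} → x ∈ S → x ∈ Generated S
    identity∈ : ε ∈ Generated S
    product∈  : ∀ {x y} → x ∈ Generated S → y ∈ Generated S →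
                x ∙ y ∈ Generated S
    inverse∈  : ∀ {x} → x ∈ Generated S → x ⁻¹ ∈ Generated S
    respects  : ∀ {x y} → x ≈ y → x ∈ Generated S → y ∈ Generated S

  Generates : Pred Carrier p → Set (c ⊔ ℓ ⊔ p)
  Generates S = ∀ x → x ∈ Generated S

  -- The cardinalities are used to decide adjacency and to enumerate the
  -- vertices; the other hypotheses make the graph well defined and simple.
  Cay : ∀ {n m} (S : Pred Carrier p) → S Respects _≈_ →
        setoid HasCardinality n → Subsetoid setoid S HasCardinality m →
        ε ∉ S → S ≐ InverseSet S → FiniteSimpleGraph c ℓ p
  Cay {n = n} S S-resp |G|≡n |S|≡m ε∉S S≐S⁻¹ = record
    { vertices  = setoid
    ; Adjacent  = λ x y → x ∙ y ⁻¹ ∈ S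
    ; resp      = (λ y≈z → S-resp (∙-congˡ (⁻¹-cong y≈z)))
                , (λ y≈z → S-resp (∙-congʳ y≈z))
    ; symmetric = λ {x} {y} xy⁻¹∈S →
        proj₂ S≐S⁻¹ (x ∙ y ⁻¹ , xy⁻¹∈S , yx⁻¹≈[xy⁻¹]⁻¹ x y)
    ; loopless  = λ {x} xx⁻¹∈S → ε∉S (S-resp (inverseʳ x) xx⁻¹∈S)
    ; adjacent? = λ x y → ∈-decidable setoid |G|≡n S-resp |S|≡m (x ∙ y ⁻¹)
    ; order     = n
    ; finite    = |G|≡n
    }
    where
    open GroupProperties G using (⁻¹-anti-homo-∙; ⁻¹-involutive)

    yx⁻¹≈[xy⁻¹]⁻¹ : ∀ x y → y ∙ x ⁻¹ ≈ (x ∙ y ⁻¹) ⁻¹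
    yx⁻¹≈[xy⁻¹]⁻¹ x y = ≈-sym
      (≈-trans (⁻¹-anti-homo-∙ x (y ⁻¹)) (∙-congʳ (⁻¹-involutive y)))

------------------------------------------------------------------------
-- Cyclic, symmetric and dihedral groups

-- Integers modulo m.
ℤ/-setoid : ℕ → Setoid 0ℓ 0ℓ
ℤ/-setoid m = record
  { Carrier       = ℤ
  ; _≈_           = λ i j → + m ∣ i ℤ.- j
  ; isEquivalence = record
    { refl  = λ {i} → divides ℤ.0ℤ (ℤ.+-inverseʳ i)
    ; sym   = λ {i} {j} d → subst (+ m ∣_) (sym-eq i j) (∣m⇒∣-m d)
    ; trans = λ {i} {j} {k} d e →
        subst (+ m ∣_) (trans-eq i j k) (∣m∣n⇒∣m+n d e)
    }
  }
  where
  sym-eq : ∀ i j → ℤ.- (i ℤ.- j) ≡ j ℤ.- i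
  sym-eq = solve-∀

  trans-eq : ∀ i j k → (i ℤ.- j) ℤ.+ (j ℤ.- k) ≡ i ℤ.- k
  trans-eq = solve-∀

module _ (m : ℕ) where
  open Setoid (ℤ/-setoid m) using (_≈_; reflexive)

  private
    +-cong : ∀ {i i′ j j′} → i ≈ i′ → j ≈ j′ → i ℤ.+ j ≈ i′ ℤ.+ j′
    +-cong {i} {i′} {j} {j′} d e =
      subst (+ m ∣_) (eq i i′ j j′) (∣m∣n⇒∣m+n d e)
      where
      eq : ∀ i i′ j j′ →
           (i ℤ.- i′) ℤ.+ (j ℤ.- j′) ≡ (i ℤ.+ j) ℤ.- (i′ ℤ.+ j′)
      eq = solve-∀

    *-congˡ : ∀ k {i j} → i ≈ j → k ℤ.* i ≈ k ℤ.* j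
    *-congˡ k {i} {j} d = subst (+ m ∣_) (eq k i j) (∣n⇒∣m*n k d)
      where
      eq : ∀ k i j → k ℤ.* (i ℤ.- j) ≡ k ℤ.* i ℤ.- k ℤ.* j
      eq = solve-∀

    neg-cong : ∀ {i j} → i ≈ j → ℤ.- i ≈ ℤ.- j
    neg-cong {i} {j} d = subst (+ m ∣_) (eq i j) (∣m⇒∣-m d)
      where
      eq : ∀ i j → ℤ.- (i ℤ.- j) ≡ ℤ.- i ℤ.- ℤ.- j
      eq = solve-∀

  ℤ/ : Group 0ℓ 0ℓ
  ℤ/ = record
    { Carrier = ℤ
    ; _≈_     = _≈_
    ; _∙_     = ℤ._+_
    ; ε       = ℤ.0ℤ
    ; _⁻¹     = ℤ.-_
    ; isGroup = record
      { isMonoid = record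
        { isSemigroup = record
          { isMagma = record
            { isEquivalence = Setoid.isEquivalence (ℤ/-setoid m)
            ; ∙-cong        = λ {i} {i′} {j} {j′} → +-cong {i} {i′} {j} {j′}
            }
          ; assoc = λ i j k → reflexive (ℤ.+-assoc i j k)
          }
        ; identity = (λ i → reflexive (ℤ.+-identityˡ i))
                   , (λ i → reflexive (ℤ.+-identityʳ i))
        }
      ; inverse = (λ i → reflexive (ℤ.+-inverseˡ i))
                , (λ i → reflexive (ℤ.+-inverseʳ i))
      ; ⁻¹-cong = λ {i} {j} → neg-cong {i} {j}
      }
    }

  -- The dihedral group of order 2m, for m ≥ 1, as the semidirect product of
  -- ℤ/m and {1 , -1}: the pair (i , s) stands for rⁱ when s is 1 and for rⁱf
  -- when s is -1, where r is a rotation of order m and f is a reflection, so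
  -- that f rʲ = r⁻ʲ f.
  Dihedral : Group 0ℓ 0ℓ
  Dihedral = record
    { Carrier = ℤ × Sign
    ; _≈_     = Setoid._≈_ D
    ; _∙_     = λ (i , s) (j , t) → i ℤ.+ ⟦ s ⟧ ℤ.* j , s Sign.* t
    ; ε       = ℤ.0ℤ , Sign.+
    ; _⁻¹     = λ (i , s) → ℤ.- (⟦ s ⟧ ℤ.* i) , s
    ; isGroup = record
      { isMonoid = record
        { isSemigroup = record
          { isMagma = record
            { isEquivalence = Setoid.isEquivalence D
            ; ∙-cong = λ { {i , s} {i′ , _} {j , t} {j′ , _} (d , refl) (e , refl) →
                +-cong {i} {i′} {⟦ s ⟧ ℤ.* j} {⟦ s ⟧ ℤ.* j′}
                  d (*-congˡ ⟦ s ⟧ {j} {j′} e)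
                , refl }
            }
          ; assoc = λ (i , s) (j , t) (k , u) →
              reflexive (assoc-eq i s j t k) , Sign.*-assoc s t u
          }
        ; identity =
            (λ (i , s) → reflexive (identityˡ-eq i) , refl)
          , (λ (i , s) → reflexive (identityʳ-eq ⟦ s ⟧ i) , Sign.*-identityʳ s)
        }
      ; inverse =
          (λ (i , s) → reflexive (ℤ.+-inverseˡ (⟦ s ⟧ ℤ.* i)) , Sign.s*s≡+ s)
        , (λ (i , s) → reflexive (inverseʳ-eq i s) , Sign.s*s≡+ s)
      ; ⁻¹-cong = λ { {i , s} {j , _} (d , refl) →
          neg-cong {⟦ s ⟧ ℤ.* i} {⟦ s ⟧ ℤ.* j} (*-congˡ ⟦ s ⟧ {i} {j} d) , refl }
      }
    }
    where
    D : Setoid 0ℓ 0ℓ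
    D = ×-setoid (ℤ/-setoid m) (≡.setoid Sign)

    ⟦⟧-homo : ∀ s t → ⟦ s Sign.* t ⟧ ≡ ⟦ s ⟧ ℤ.* ⟦ t ⟧
    ⟦⟧-homo Sign.+ Sign.+ = refl
    ⟦⟧-homo Sign.+ Sign.- = refl
    ⟦⟧-homo Sign.- Sign.+ = refl
    ⟦⟧-homo Sign.- Sign.- = refl

    distrib : ∀ i x j y k →
              (i ℤ.+ x ℤ.* j) ℤ.+ (x ℤ.* y) ℤ.* k ≡ i ℤ.+ x ℤ.* (j ℤ.+ y ℤ.* k)
    distrib = solve-∀

    assoc-eq : ∀ i s j t k →
               (i ℤ.+ ⟦ s ⟧ ℤ.* j) ℤ.+ ⟦ s Sign.* t ⟧ ℤ.* k ≡
               i ℤ.+ ⟦ s ⟧ ℤ.* (j ℤ.+ ⟦ t ⟧ ℤ.* k)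
    assoc-eq i s j t k = ≡.trans
      (cong (λ x → (i ℤ.+ ⟦ s ⟧ ℤ.* j) ℤ.+ x ℤ.* k) (⟦⟧-homo s t))
      (distrib i ⟦ s ⟧ j ⟦ t ⟧ k)

    identityˡ-eq : ∀ i → ℤ.0ℤ ℤ.+ ℤ.1ℤ ℤ.* i ≡ i
    identityˡ-eq = solve-∀

    identityʳ-eq : ∀ x i → i ℤ.+ x ℤ.* ℤ.0ℤ ≡ i
    identityʳ-eq = solve-∀

    inverseʳ-eq : ∀ i s → i ℤ.+ ⟦ s ⟧ ℤ.* ℤ.- (⟦ s ⟧ ℤ.* i) ≡ ℤ.0ℤ
    inverseʳ-eq i Sign.+ = eq i
      where
      eq : ∀ i → i ℤ.+ ℤ.1ℤ ℤ.* ℤ.- (ℤ.1ℤ ℤ.* i) ≡ ℤ.0ℤ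
      eq = solve-∀
    inverseʳ-eq i Sign.- = eq i
      where
      eq : ∀ i → i ℤ.+ ℤ.-1ℤ ℤ.* ℤ.- (ℤ.-1ℤ ℤ.* i) ≡ ℤ.0ℤ
      eq = solve-∀

-- Permutations of Fin n, where π ∙ ρ applies ρ first.
Symmetric-group : ℕ → Group 0ℓ 0ℓ
Symmetric-group n = record
  { Carrier = Permutation′ n
  ; _≈_     = Perm._≈_
  ; _∙_     = λ π ρ → ρ ∘ₚ π
  ; ε       = Perm.id
  ; _⁻¹     = flip
  ; isGroup = record
    { isMonoid = record
      { isSemigroup = record
        { isMagma = record
          { isEquivalence = record
            { refl  = λ _ → refl
            ; sym   = λ π≈ρ i → ≡.sym (π≈ρ i)
            ; trans = λ π≈ρ ρ≈σ i → ≡.trans (π≈ρ i) (ρ≈σ i)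
            }
          ; ∙-cong = λ {π} {π′} {ρ} {ρ′} π≈π′ ρ≈ρ′ i →
              ≡.trans (π≈π′ (ρ ⟨$⟩ʳ i)) (cong (π′ ⟨$⟩ʳ_) (ρ≈ρ′ i))
          }
        ; assoc = λ _ _ _ _ → refl
        }
      ; identity = (λ _ _ → refl) , (λ _ _ → refl)
      }
    ; inverse = (λ π _ → Perm.inverseˡ π) , (λ π _ → Perm.inverseʳ π)
    ; ⁻¹-cong = λ {π} {ρ} π≈ρ i → ≡.trans
        (cong (π ⟨$⟩ˡ_) (≡.trans (≡.sym (Perm.inverseʳ ρ))
                                  (≡.sym (π≈ρ (ρ ⟨$⟩ˡ i)))))
        (Perm.inverseˡ π)
    }
  }

{-# OPTIONS --safe #-}

-- Write S = {a , b}.  Either b = a⁻¹ and G is cyclic, or a and b are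
-- involutions and G is dihedral with rotation ba; in both cases Cay(S : G) is
-- the cycle Cₙ.  Summing a signed dominating function over all closed
-- neighbourhoods counts every vertex three times, so n ≤ 3 (n - 2k), where k is
-- the number of vertices of sign -1; conversely, giving sign -1 to the vertices
-- 0, 3, 6, …, 3 (⌊n/3⌋ - 1) of the cycle is signed dominating.  Hence
-- γ_S = n - 2 ⌊n/3⌋, which equals n - 4 exactly when n is 6, 7 or 8.

module Submission where

open import Defs
open import Algebra.Bundles using (AbelianGroup; Group)
import Algebra.Morphism.Construct.Composition as MorphismComposition
open import Algebra.Morphism.Structures using (module GroupMorphisms)
import Algebra.Properties.CommutativeMonoid.Sum as CommutativeMonoidSum
import Algebra.Properties.Group as GroupProperties
import Algebra.Properties.Monoid.Mult as Mult
open import Data.Bool.Base using (if_then_else_)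
open import Data.Empty using (⊥; ⊥-elim)
open import Data.Fin.Base as Fin using (Fin; toℕ)
open import Data.Fin.Patterns using (0F; 1F; 2F)
open import Data.Fin.Permutation as Perm using (_⟨$⟩ʳ_)
import Data.Fin.Properties as Fin
open import Data.Integer.Base as ℤ using (ℤ; +_; -[1+_]; _-_)
open import Data.Integer.DivMod using (_%ℕ_; _/ℕ_; n%ℕd<d; a≡a%ℕn+[a/ℕn]*n)
open import Data.Integer.Divisibility.Signed
  using (_∣_; divides; ∣⇒∣ᵤ; ∣m⇒∣-m; ∣m∣n⇒∣m-n; *-monoˡ-∣)
import Data.Integer.Properties as ℤ
open import Data.Integer.Tactic.RingSolver using (solve-∀)
open import Data.Nat.Base as ℕ using (ℕ; zero; suc; z≤n; s≤s)
import Data.Nat.Divisibility as ℕ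
open import Data.Nat.DivMod as ℕ using (_/_; _%_)
open import Data.Nat.Induction using (<-rec)
import Data.Nat.Properties as ℕ
open import Data.Product.Base as Product using (_×_; _,_; proj₁; proj₂; ∃-syntax)
open import Data.Product.Function.NonDependent.Setoid using (_×-inverse_)
open import Data.Product.Relation.Binary.Pointwise.NonDependent using (Pointwise-≡↔≡)
open import Data.Sign.Base as Sign using (Sign)
open import Data.Sum.Base as Sum using (_⊎_; inj₁; inj₂)
open import Data.Vec.Functional using (removeAt)
open import Function.Base using (_∘_; id; case_of_)
open import Function.Bundles using (_⇔_; mk⇔; mk↔ₛ′; Equivalence; Func; Inverse; Injection)
import Function.Construct.Composition as Composition
import Function.Construct.Symmetry as Symmetry
open import Function.Properties.Bijection using (Bijection⇒Inverse)
open import Function.Properties.Inverse using (Inverse⇒Injection)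
open import Level using (Level; _⊔_)
open import Relation.Binary.Bundles using (Setoid)
open import Relation.Binary.Definitions using (_Respects_)
open import Relation.Binary.PropositionalEquality as ≡ using (_≡_; _≢_; cong)
open import Relation.Nullary using (¬_; Dec; does; yes; no; contradiction)
open import Relation.Nullary.Decidable
  using (_×-dec_; _⊎-dec_; dec-true; dec-false; does-⇔; from-yes)
open import Relation.Unary as Unary using (Pred; _∈_; _∉_; _≐_)

-- Adjacency of x and v means x = sv with s in S, so the neighbours of v are av and bv, and left
-- multiplication moves along the cycle. The two kinds of groups differ in how they do this: in the
-- cyclic case a is always a step forward, whereas in the dihedral case a and b exchange directions
-- between rotations and reflections. `CyclicPosition` keeps only what both cases share, a position
-- in ℤ/n such that a and b move it by 1 in opposite directions, and the dominating function is
-- built from positions alone. The lower bound rests on local counting and on the parity of the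
-- weight. The value of γ_S is thus a function of n, so passing from the listed groups to n - 4 is a
-- matter of their orders. The converse takes the group itself from the classification and needs one
-- genuine coincidence, S₃ ≅ `Dihedral 3`.

private
  variable
    c c′ ℓ ℓ′ p : Level

-- Arithmetic

least : {P : Pred ℕ p} → Unary.Decidable P → ∀ m → P m →
        ∃[ k ] P k × (∀ {j} → j ℕ.< k → ¬ P j)
least {P = P} P? = <-rec _ step
  where
  step : ∀ m → (∀ {j} → j ℕ.< m → P j → ∃[ k ] P k × (∀ {j} → j ℕ.< k → ¬ P j)) →
         P m → ∃[ k ] P k × (∀ {j} → j ℕ.< k → ¬ P j)
  step m smaller Pm with ℕ.anyUpTo? P? m
  ... | yes (j , j<m , Pj) = smaller j<m Pj
  ... | no  none           = m , Pm , λ j<m Pj → none (_ , j<m , Pj)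

even∨odd : ∀ z → (∃[ q ] z ≡ q ℤ.* + 2) ⊎ (∃[ q ] z ≡ ℤ.1ℤ ℤ.+ q ℤ.* + 2)
even∨odd z with z %ℕ 2 | n%ℕd<d z 2 | a≡a%ℕn+[a/ℕn]*n z 2
... | zero        | _                | eq = inj₁ (z /ℕ 2 , ≡.trans eq (ℤ.+-identityˡ _))
... | suc zero    | _                | eq = inj₂ (z /ℕ 2 , eq)
... | suc (suc _) | s≤s (s≤s ()) | _

∣i∣<m∧m∣i⇒i≡0 : ∀ {m i} → ℤ.∣ i ∣ ℕ.< m → + m ∣ i → i ≡ ℤ.0ℤ
∣i∣<m∧m∣i⇒i≡0 {i = i} ∣i∣<m m∣i with ℤ.∣ i ∣ in eq | ∣⇒∣ᵤ m∣i
... | zero  | _   = ℤ.∣i∣≡0⇒i≡0 eq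
... | suc k | m∣k = contradiction m∣k (ℕ.>⇒∤ ∣i∣<m)

∣i-j∣≤∣i∣+∣j∣ : ∀ i j → ℤ.∣ i - j ∣ ℕ.≤ ℤ.∣ i ∣ ℕ.+ ℤ.∣ j ∣
∣i-j∣≤∣i∣+∣j∣ i j = ≡.subst (λ k → ℤ.∣ i - j ∣ ℕ.≤ ℤ.∣ i ∣ ℕ.+ k) (ℤ.∣-i∣≡∣i∣ j)
  (ℤ.∣i+j∣≤∣i∣+∣j∣ i (ℤ.- j))

-- The closed neighbourhoods of the multiples of 3 below 3k ≤ n are disjoint in ℤ/n.
multiples-of-3-separated :
  ∀ {n k} → k ℕ.* 3 ℕ.≤ n → (i j : Fin k) → ∀ {x δ δ′} → ℤ.∣ δ ∣ ℕ.≤ 1 → ℤ.∣ δ′ ∣ ℕ.≤ 1 →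
  let open Setoid (ℤ/-setoid n) in
  x ℤ.+ δ ≈ + toℕ i ℤ.* + 3 → x ℤ.+ δ′ ≈ + toℕ j ℤ.* + 3 → i ≡ j × δ ≡ δ′
multiples-of-3-separated {n} {k} 3k≤n i j {x} {δ} {δ′} ∣δ∣≤1 ∣δ′∣≤1 x+δ≈3i x+δ′≈3j =
  i≡j , δ≡δ′
  where
  ι = + toℕ i - + toℕ j

  ∣δ-δ′∣<3 : ℤ.∣ δ - δ′ ∣ ℕ.< 3
  ∣δ-δ′∣<3 = s≤s (ℕ.≤-trans (∣i-j∣≤∣i∣+∣j∣ δ δ′) (ℕ.+-mono-≤ ∣δ∣≤1 ∣δ′∣≤1))

  -- Subtracting the two congruences shows that n divides this integer. Its absolute value is at
  -- most 2 + 3(k - 1) = 3k - 1 < n, so it vanishes; here 3k ≤ n also keeps the last multiple away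
  -- from 0 around the cycle.
  difference : (δ - δ′) - ι ℤ.* + 3 ≡ ℤ.0ℤ
  difference = ∣i∣<m∧m∣i⇒i≡0 bound
    (≡.subst (+ n ∣_) (eq x δ δ′ (+ toℕ i) (+ toℕ j)) (∣m∣n⇒∣m-n x+δ≈3i x+δ′≈3j))
    where
    eq : ∀ x δ δ′ i j → ((x ℤ.+ δ) - i ℤ.* + 3) - ((x ℤ.+ δ′) - j ℤ.* + 3) ≡ (δ - δ′) - (i - j) ℤ.* + 3
    eq = solve-∀

    open ℕ.≤-Reasoning
    bound : ℤ.∣ (δ - δ′) - ι ℤ.* + 3 ∣ ℕ.< n
    bound = begin-strict
      ℤ.∣ (δ - δ′) - ι ℤ.* + 3 ∣                 ≤⟨ ∣i-j∣≤∣i∣+∣j∣ (δ - δ′) (ι ℤ.* + 3) ⟩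
      ℤ.∣ δ - δ′ ∣ ℕ.+ ℤ.∣ ι ℤ.* + 3 ∣           ≡⟨ cong (ℤ.∣ δ - δ′ ∣ ℕ.+_) (ℤ.abs-* ι (+ 3)) ⟩
      ℤ.∣ δ - δ′ ∣ ℕ.+ ℤ.∣ ι ∣ ℕ.* 3             <⟨ ℕ.+-monoˡ-< (ℤ.∣ ι ∣ ℕ.* 3) ∣δ-δ′∣<3 ⟩
      3 ℕ.+ ℤ.∣ ι ∣ ℕ.* 3                        ≤⟨ ℕ.*-monoˡ-≤ 3 ∣ι∣<k ⟩
      k ℕ.* 3                                    ≤⟨ 3k≤n ⟩
      n                                          ∎
      where
      ∣ι∣<k : ℤ.∣ ι ∣ ℕ.< k
      ∣ι∣<k = ≡.subst (λ z → ℤ.∣ z ∣ ℕ.< k) (≡.sym (ℤ.m-n≡m⊖n (toℕ i) (toℕ j)))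
        (ℕ.≤-<-trans (ℤ.∣m⊝n∣≤m⊔n (toℕ i) (toℕ j)) (ℕ.⊔-lub (Fin.toℕ<n i) (Fin.toℕ<n j)))

  -- The vanishing difference makes δ - δ′ a multiple of 3, of absolute value at most 2.
  δ-δ′≡0 : δ - δ′ ≡ ℤ.0ℤ
  δ-δ′≡0 = ∣i∣<m∧m∣i⇒i≡0 ∣δ-δ′∣<3 (divides ι (ℤ.i-j≡0⇒i≡j (δ - δ′) (ι ℤ.* + 3) difference))

  δ≡δ′ : δ ≡ δ′
  δ≡δ′ = ℤ.i-j≡0⇒i≡j δ δ′ δ-δ′≡0

  i≡j : i ≡ j
  i≡j = Fin.toℕ-injective (ℤ.+-injective (ℤ.i-j≡0⇒i≡j _ _ (ℤ.*-cancelʳ-≡ ι ℤ.0ℤ (+ 3)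
    (≡.sym (≡.trans (≡.sym δ-δ′≡0) (ℤ.i-j≡0⇒i≡j (δ - δ′) (ι ℤ.* + 3) difference))))))

n/3≡2⇒6≤n≤8 : ∀ n → n / 3 ≡ 2 → n ≡ 6 ⊎ n ≡ 7 ⊎ n ≡ 8
n/3≡2⇒6≤n≤8 n n/3≡2
  with n % 3 | ℕ.m%n<n n 3 | ≡.trans (ℕ.m≡m%n+[m/n]*n n 3) (cong (λ q → n % 3 ℕ.+ q ℕ.* 3) n/3≡2)
... | 0 | _ | n≡6 = inj₁ n≡6
... | 1 | _ | n≡7 = inj₂ (inj₁ n≡7)
... | 2 | _ | n≡8 = inj₂ (inj₂ n≡8)
... | suc (suc (suc _)) | s≤s (s≤s (s≤s ())) | _

n-2q≡n-4⇒q≡2 : ∀ n q → + n - + 2 ℤ.* + q ≡ + n - + 4 → q ≡ 2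
n-2q≡n-4⇒q≡2 n q eq = ℤ.+-injective (ℤ.*-cancelˡ-≡ (+ 2) (+ q) (+ 2)
  (ℤ.neg-injective (GroupProperties.∙-cancelˡ (AbelianGroup.group ℤ.+-0-abelianGroup) (+ n) _ _ eq)))

-- Finite sums of integers

open CommutativeMonoidSum ℤ.+-0-commutativeMonoid
  using (sum; sum-cong-≗; sum-remove; sum-permute; sum-replicate-zero; ∑-distrib-+; ∑-comm)

sum-const : ∀ n c → sum {n} (λ _ → c) ≡ + n ℤ.* c
sum-const zero    c = ≡.refl
sum-const (suc n) c = ≡.trans (cong (λ z → c ℤ.+ z) (sum-const n c)) (≡.sym (ℤ.suc-* (+ n) c))

sum-zero : ∀ {n} {f : Fin n → ℤ} → (∀ i → f i ≡ ℤ.0ℤ) → sum f ≡ ℤ.0ℤ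
sum-zero {n} f≡0 = ≡.trans (sum-cong-≗ f≡0) (sum-replicate-zero n)

sum-single : ∀ {n} (f : Fin n → ℤ) i → (∀ j → j ≢ i → f j ≡ ℤ.0ℤ) → sum f ≡ f i
sum-single {suc n} f i f≡0 = begin
  sum f                          ≡⟨ sum-remove f ⟩
  f i ℤ.+ sum (removeAt f i)     ≡⟨ cong (λ z → f i ℤ.+ z) (sum-zero λ j → f≡0 _ (Fin.punchInᵢ≢i i j)) ⟩
  f i ℤ.+ ℤ.0ℤ                   ≡⟨ ℤ.+-identityʳ (f i) ⟩
  f i                            ∎
  where open ≡.≡-Reasoning

n≤sum : ∀ {n} {f : Fin n → ℤ} → (∀ i → ℤ.1ℤ ℤ.≤ f i) → + n ℤ.≤ sum f
n≤sum {zero}  1≤f = ℤ.≤-refl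
n≤sum {suc n} 1≤f = ℤ.+-mono-≤ (1≤f Fin.zero) (n≤sum (λ i → 1≤f (Fin.suc i)))

-- Each sign -1 lowers the sum of n ones by 2. This parity information sharpens the lower bound: for
-- n = 8, n ≤ 3w alone gives w ≥ 3, whereas an even weight must be at least 4.
sum-signs : ∀ {n} (s : Fin n → Sign) → ∃[ k ] sum (λ i → ⟦ s i ⟧) ≡ + n - + 2 ℤ.* + k
sum-signs {zero}  s = 0 , ≡.refl
sum-signs {suc n} s with s Fin.zero | sum-signs (λ i → s (Fin.suc i))
... | Sign.+ | k , eq = k , ≡.trans (cong (λ z → ℤ.1ℤ ℤ.+ z) eq) (positive (+ n) (+ k))
  where
  positive : ∀ n k → ℤ.1ℤ ℤ.+ (n - + 2 ℤ.* k) ≡ (ℤ.1ℤ ℤ.+ n) - + 2 ℤ.* k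
  positive = solve-∀
... | Sign.- | k , eq = suc k , ≡.trans (cong (λ z → ℤ.-1ℤ ℤ.+ z) eq) (negative (+ n) (+ k))
  where
  negative : ∀ n k → ℤ.-1ℤ ℤ.+ (n - + 2 ℤ.* k) ≡ (ℤ.1ℤ ℤ.+ n) - + 2 ℤ.* (ℤ.1ℤ ℤ.+ k)
  negative = solve-∀

-- Disjointness makes indicators additive. Replacing the decision of P by that of the disjunction
-- leaves only the decisions of A and B to be split.
if-⊎ : ∀ {p a b} {P : Set p} {A : Set a} {B : Set b} (P? : Dec P) (A? : Dec A) (B? : Dec B) →
       P ⇔ (A ⊎ B) → ¬ (A × B) → ∀ z →
       (if does P? then z else ℤ.0ℤ) ≡ (if does A? then z else ℤ.0ℤ) ℤ.+ (if does B? then z else ℤ.0ℤ)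
if-⊎ P? A? B? P⇔A⊎B disjoint z
  with does P? | does-⇔ P⇔A⊎B P? (A? ⊎-dec B?)
... | _ | ≡.refl with A? | B?
... | yes a | yes b = contradiction (a , b) disjoint
... | yes _ | no _  = ≡.sym (ℤ.+-identityʳ z)
... | no _  | yes _ = ≡.sym (ℤ.+-identityˡ z)
... | no _  | no _  = ≡.refl

module _ (A : Setoid c ℓ) {n} (|A|≡n : A HasCardinality n) where
  open Setoid A
  open Inverse |A|≡n using (to; from; inverseˡ; inverseʳ)

  _≈?_ : ∀ x y → Dec (x ≈ y)
  _≈?_ = ≈-decidable A |A|≡n

  -- The enumeration is a bijection, so `from x` is the only index that contributes.
  sum-indicator : ∀ {f : Carrier → ℤ} → (∀ {x y} → x ≈ y → f x ≡ f y) → ∀ x →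
                  sum (λ i → if does (to i ≈? x) then f (to i) else ℤ.0ℤ) ≡ f x
  sum-indicator {f} f-cong x = begin
    sum F           ≡⟨ sum-single F (from x) (λ j j≢x → cong (λ b → if b then f (to j) else ℤ.0ℤ)
                         (dec-false (to j ≈? x) λ to[j]≈x → j≢x (≡.sym (inverseʳ (sym to[j]≈x))))) ⟩
    F (from x)      ≡⟨ cong (λ b → if b then f (to (from x)) else ℤ.0ℤ)
                         (dec-true (to (from x) ≈? x) (inverseˡ ≡.refl)) ⟩
    f (to (from x)) ≡⟨ f-cong (inverseˡ ≡.refl) ⟩
    f x             ∎
    where
    open ≡.≡-Reasoning
    F : Fin n → ℤ
    F i = if does (to i ≈? x) then f (to i) else ℤ.0ℤ

  -- Conjugating τ by the enumeration gives a permutation of `Fin n`, under which a finite sum is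
  -- invariant.
  sum-reindex : ∀ {f : Carrier → ℤ} → (∀ {x y} → x ≈ y → f x ≡ f y) → (τ : Inverse A A) →
                sum (λ i → f (Inverse.to τ (to i))) ≡ sum (λ i → f (to i))
  sum-reindex {f} f-cong τ = ≡.sym (≡.trans
    (sum-permute (λ i → f (to i)) (Composition.inverse |A|≡n (Composition.inverse τ (Symmetry.inverse |A|≡n))))
    (sum-cong-≗ {n} (λ i → f-cong (inverseˡ {Inverse.to τ (to i)} ≡.refl))))

-- Powers and orders of group elements

module Powers (G : Group c ℓ) where
  open Group G hiding (_-_)
  open GroupProperties G
  open Mult monoid using () renaming (_×_ to _·_; ×-congʳ to ·-congʳ)
  open import Relation.Binary.Reasoning.Setoid setoid

  infixr 8 _^_

  _^_ : Carrier → ℤ → Carrier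
  x ^ (+ n)    = n · x
  x ^ -[1+ n ] = suc n · (x ⁻¹)

  ^-cong : ∀ {x y} z → x ≈ y → x ^ z ≈ y ^ z
  ^-cong (+ n)    x≈y = ·-congʳ n x≈y
  ^-cong -[1+ n ] x≈y = ·-congʳ (suc n) (⁻¹-cong x≈y)

  ^-congʳ : ∀ x {i j} → i ≡ j → x ^ i ≈ x ^ j
  ^-congʳ x i≡j = reflexive (cong (x ^_) i≡j)

  ^-suc : ∀ x z → x ^ (ℤ.1ℤ ℤ.+ z) ≈ x ∙ x ^ z
  ^-suc x (+ n)          = refl
  ^-suc x -[1+ zero ]    = sym (\\-leftDividesˡ x ε)
  ^-suc x -[1+ suc n ]   = sym (\\-leftDividesˡ x _)

  ^-pred : ∀ x z → x ^ (ℤ.-1ℤ ℤ.+ z) ≈ x ⁻¹ ∙ x ^ z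
  ^-pred x z = y≈x\\z x _ _ (begin
    x ∙ x ^ (ℤ.-1ℤ ℤ.+ z)        ≈⟨ ^-suc x (ℤ.-1ℤ ℤ.+ z) ⟨
    x ^ (ℤ.1ℤ ℤ.+ (ℤ.-1ℤ ℤ.+ z)) ≈⟨ ^-congʳ x (ℤ.suc-pred z) ⟩
    x ^ z                        ∎)

  ^-homo-+ : ∀ x i j → x ^ (i ℤ.+ j) ≈ x ^ i ∙ x ^ j
  ^-homo-+ x (+ zero) j = begin
    x ^ (ℤ.0ℤ ℤ.+ j)  ≈⟨ ^-congʳ x (ℤ.+-identityˡ j) ⟩
    x ^ j             ≈⟨ identityˡ _ ⟨
    ε ∙ x ^ j         ∎
  ^-homo-+ x (+ suc n) j = begin
    x ^ (+ suc n ℤ.+ j)           ≈⟨ ^-congʳ x (ℤ.+-assoc ℤ.1ℤ (+ n) j) ⟩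
    x ^ (ℤ.1ℤ ℤ.+ (+ n ℤ.+ j))    ≈⟨ ^-suc x (+ n ℤ.+ j) ⟩
    x ∙ x ^ (+ n ℤ.+ j)           ≈⟨ ∙-congˡ (^-homo-+ x (+ n) j) ⟩
    x ∙ (x ^ (+ n) ∙ x ^ j)       ≈⟨ assoc _ _ _ ⟨
    x ∙ x ^ (+ n) ∙ x ^ j         ∎
  ^-homo-+ x -[1+ zero ] j = begin
    x ^ (ℤ.-1ℤ ℤ.+ j)  ≈⟨ ^-pred x j ⟩
    x ⁻¹ ∙ x ^ j       ≈⟨ ∙-congʳ (identityʳ _) ⟨
    x ⁻¹ ∙ ε ∙ x ^ j   ∎
  ^-homo-+ x -[1+ suc n ] j = begin
    x ^ (-[1+ suc n ] ℤ.+ j)            ≈⟨ ^-congʳ x (ℤ.+-assoc ℤ.-1ℤ -[1+ n ] j) ⟩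
    x ^ (ℤ.-1ℤ ℤ.+ (-[1+ n ] ℤ.+ j))    ≈⟨ ^-pred x (-[1+ n ] ℤ.+ j) ⟩
    x ⁻¹ ∙ x ^ (-[1+ n ] ℤ.+ j)         ≈⟨ ∙-congˡ (^-homo-+ x -[1+ n ] j) ⟩
    x ⁻¹ ∙ (x ^ -[1+ n ] ∙ x ^ j)       ≈⟨ assoc _ _ _ ⟨
    x ⁻¹ ∙ x ^ -[1+ n ] ∙ x ^ j         ∎

  ^-neg : ∀ x z → x ^ (ℤ.- z) ≈ (x ^ z) ⁻¹
  ^-neg x z = inverseˡ-unique _ _ (begin
    x ^ (ℤ.- z) ∙ x ^ z     ≈⟨ ^-homo-+ x (ℤ.- z) z ⟨
    x ^ (ℤ.- z ℤ.+ z)       ≈⟨ ^-congʳ x (ℤ.+-inverseˡ z) ⟩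
    ε                       ∎)

  ⁻¹-^ : ∀ x z → (x ⁻¹) ^ z ≈ x ^ (ℤ.- z)
  ⁻¹-^ x (+ zero)  = refl
  ⁻¹-^ x (+ suc n) = refl
  ⁻¹-^ x -[1+ n ]  = ·-congʳ (suc n) (⁻¹-involutive x)

  -- Conjugation by a carries x to y, hence powers of x to powers of y. With y = x⁻¹ this is the
  -- dihedral relation; with a = x = y it says that an element commutes with its powers.
  ^-intertwine : ∀ {a x y} → a ∙ x ≈ y ∙ a → ∀ z → a ∙ x ^ z ≈ y ^ z ∙ a
  ^-intertwine {a} {x} {y} ax≈ya = λ where
      (+ n)    → nat ax≈ya n
      -[1+ n ] → nat ax⁻¹≈y⁻¹a (suc n)
    where
    nat : ∀ {u v} → a ∙ u ≈ v ∙ a → ∀ n → a ∙ n · u ≈ n · v ∙ a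
    nat         au≈va zero    = trans (identityʳ a) (sym (identityˡ a))
    nat {u} {v} au≈va (suc n) = begin
      a ∙ (u ∙ n · u)  ≈⟨ assoc _ _ _ ⟨
      a ∙ u ∙ n · u    ≈⟨ ∙-congʳ au≈va ⟩
      v ∙ a ∙ n · u    ≈⟨ assoc _ _ _ ⟩
      v ∙ (a ∙ n · u)  ≈⟨ ∙-congˡ (nat au≈va n) ⟩
      v ∙ (n · v ∙ a)  ≈⟨ assoc _ _ _ ⟨
      v ∙ n · v ∙ a    ∎

    ax⁻¹≈y⁻¹a : a ∙ x ⁻¹ ≈ y ⁻¹ ∙ a
    ax⁻¹≈y⁻¹a = sym (x≈z//y _ _ _ (begin
      y ⁻¹ ∙ a ∙ x    ≈⟨ assoc _ _ _ ⟩
      y ⁻¹ ∙ (a ∙ x)  ≈⟨ ∙-congˡ ax≈ya ⟩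
      y ⁻¹ ∙ (y ∙ a)  ≈⟨ \\-leftDividesʳ y a ⟩
      a               ∎))

  ^-* : ∀ x i j → x ^ (i ℤ.* j) ≈ (x ^ j) ^ i
  ^-* x (+ n)    j = nat n j
    where
    nat : ∀ n j → x ^ (+ n ℤ.* j) ≈ (x ^ j) ^ (+ n)
    nat zero    j = refl
    nat (suc n) j = begin
      x ^ (+ suc n ℤ.* j)       ≈⟨ ^-congʳ x (ℤ.suc-* (+ n) j) ⟩
      x ^ (j ℤ.+ + n ℤ.* j)     ≈⟨ ^-homo-+ x j (+ n ℤ.* j) ⟩
      x ^ j ∙ x ^ (+ n ℤ.* j)   ≈⟨ ∙-congˡ (nat n j) ⟩
      x ^ j ∙ (x ^ j) ^ (+ n)   ∎
  ^-* x -[1+ n ] j = begin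
    x ^ (-[1+ n ] ℤ.* j)          ≈⟨ ^-congʳ x (eq (+ suc n) j) ⟩
    x ^ (+ suc n ℤ.* ℤ.- j)       ≈⟨ ^-* x (+ suc n) (ℤ.- j) ⟩
    (x ^ (ℤ.- j)) ^ (+ suc n)     ≈⟨ ^-cong (+ suc n) (^-neg x j) ⟩
    (x ^ j) ^ -[1+ n ]            ∎
    where
    eq : ∀ i j → ℤ.- i ℤ.* j ≡ i ℤ.* ℤ.- j
    eq = solve-∀

  ε-^ : ∀ z → ε ^ z ≈ ε
  ε-^ z = trans (sym (^-* ε z ℤ.0ℤ)) (^-congʳ ε (ℤ.*-zeroʳ z))

  -- The order as the generator of the ideal of exponents that kill x, with 0 for infinite order.
  -- From right to left this makes powers well defined modulo d; from left to right it makes them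
  -- injective there.
  HasOrder : Carrier → ℕ → Set ℓ
  HasOrder x d = ∀ z → x ^ z ≈ ε ⇔ + d ∣ z

  -- Division with remainder: the remainder of an exponent that kills x also kills x and is below
  -- the least positive period, so it is 0. Positive exponents are written as successors, which
  -- turns minimality into a condition on k < m.
  least-period⇒order : ∀ x m → x ^ (+ suc m) ≈ ε →
                       (∀ {k} → k ℕ.< m → ¬ x ^ (+ suc k) ≈ ε) → HasOrder x (suc m)
  least-period⇒order x m period minimal z = mk⇔ divisible trivial
    where
    trivial : ∀ {z} → + suc m ∣ z → x ^ z ≈ ε
    trivial (divides q ≡.refl) = begin
      x ^ (q ℤ.* + suc m)    ≈⟨ ^-* x q (+ suc m) ⟩
      (x ^ (+ suc m)) ^ q    ≈⟨ ^-cong q period ⟩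
      ε ^ q                  ≈⟨ ε-^ q ⟩
      ε                      ∎

    r = z %ℕ suc m
    q = z /ℕ suc m

    z≡r+q*d : z ≡ + r ℤ.+ q ℤ.* + suc m
    z≡r+q*d = a≡a%ℕn+[a/ℕn]*n z (suc m)

    remainder-trivial : x ^ z ≈ ε → x ^ (+ r) ≈ ε
    remainder-trivial xᶻ≈ε = begin
      x ^ (+ r)                          ≈⟨ identityʳ _ ⟨
      x ^ (+ r) ∙ ε                      ≈⟨ ∙-congˡ (trivial (divides q ≡.refl)) ⟨
      x ^ (+ r) ∙ x ^ (q ℤ.* + suc m)    ≈⟨ ^-homo-+ x (+ r) (q ℤ.* + suc m) ⟨
      x ^ (+ r ℤ.+ q ℤ.* + suc m)        ≈⟨ ^-congʳ x z≡r+q*d ⟨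
      x ^ z                              ≈⟨ xᶻ≈ε ⟩
      ε                                  ∎

    divisible : x ^ z ≈ ε → + suc m ∣ z
    divisible xᶻ≈ε with r | n%ℕd<d z (suc m) | remainder-trivial xᶻ≈ε | z≡r+q*d
    ... | zero  | _       | _    | eq = divides q (≡.trans eq (ℤ.+-identityˡ _))
    ... | suc k | s≤s k<m | xʳ≈ε | _  = contradiction xʳ≈ε (minimal k<m)

  module _ {n} (|G|≡n : setoid HasCardinality n) where
    open Injection (Inverse⇒Injection (Symmetry.inverse |G|≡n))
      using () renaming (to to index; injective to index-injective)

    -- The n + 1 powers with exponents 0 to n cannot all differ in a group of order n; the gap
    -- between two coinciding exponents is a period.
    positive-period : ∀ x → ∃[ k ] x ^ (+ suc k) ≈ ε
    positive-period x
      with i , j , i<j , eq ← Fin.pigeonhole (ℕ.n<1+n n) (λ i → index (x ^ (+ toℕ i)))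
      with k , 1+i+k≡j ← ℕ.m≤n⇒∃[o]m+o≡n i<j
      = k , identityʳ-unique _ _ (begin
        x ^ (+ toℕ i) ∙ x ^ (+ suc k)  ≈⟨ ^-homo-+ x (+ toℕ i) (+ suc k) ⟨
        x ^ (+ (toℕ i ℕ.+ suc k))      ≈⟨ ^-congʳ x (cong +_ (≡.trans (ℕ.+-suc _ k) 1+i+k≡j)) ⟩
        x ^ (+ toℕ j)                  ≈⟨ index-injective eq ⟨
        x ^ (+ toℕ i)                  ∎)

    finite-order : ∀ x → ∃[ m ] HasOrder x (suc m)
    finite-order x
      with k , period ← positive-period x
      with m , period′ , minimal ← least (λ k → ≈-decidable setoid |G|≡n (x ^ (+ suc k)) ε) k period
      = m , least-period⇒order x m period′ minimal

-- Isomorphisms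

HasCardinality-unique : ∀ {A : Setoid c ℓ} {m n} →
                        A HasCardinality m → A HasCardinality n → m ≡ n
HasCardinality-unique |A|≡m |A|≡n =
  Perm.↔⇒≡ (Composition.inverse |A|≡m (Symmetry.inverse |A|≡n))

module _ {G : Group c ℓ} {H : Group c′ ℓ′} where
  private
    module G = Group G
    module H = Group H
  open GroupMorphisms H.rawGroup G.rawGroup

  ≅-cardinality : ∀ {n} → G ≅ H → H.setoid HasCardinality n → G.setoid HasCardinality n
  ≅-cardinality (_ , iso) |H|≡n =
    Composition.inverse |H|≡n (Symmetry.inverse (Bijection⇒Inverse record
      { cong      = ⟦⟧-cong
      ; bijective = injective , surjective
      }))
    where open GroupMorphisms.IsGroupIsomorphism iso

  module _ {ψ : H.Carrier → G.Carrier} where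
    open GroupProperties G
    open import Relation.Binary.Reasoning.Setoid G.setoid

    ∙-homo⇒isGroupHomomorphism : (∀ {x y} → x H.≈ y → ψ x G.≈ ψ y) →
                                 (∀ x y → ψ (x H.∙ y) G.≈ ψ x G.∙ ψ y) →
                                 IsGroupHomomorphism ψ
    ∙-homo⇒isGroupHomomorphism ψ-cong ∙-homo = record
      { isMonoidHomomorphism = record
        { isMagmaHomomorphism = record
          { isRelHomomorphism = record { cong = ψ-cong }
          ; homo              = ∙-homo
          }
        ; ε-homo = ε-homo
        }
      ; ⁻¹-homo = λ x → inverseˡ-unique _ _ (begin
          ψ (x H.⁻¹) G.∙ ψ x  ≈⟨ ∙-homo _ _ ⟨
          ψ (x H.⁻¹ H.∙ x)    ≈⟨ ψ-cong (H.inverseˡ x) ⟩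
          ψ H.ε               ≈⟨ ε-homo ⟩
          G.ε                 ∎)
      }
      where
      ε-homo : ψ H.ε G.≈ G.ε
      ε-homo = identityˡ-unique _ _ (G.trans (G.sym (∙-homo _ _)) (ψ-cong (H.identityˡ H.ε)))

    trivial-kernel⇒isGroupMonomorphism :
      IsGroupHomomorphism ψ → (∀ {x} → ψ x G.≈ G.ε → x H.≈ H.ε) → IsGroupMonomorphism ψ
    trivial-kernel⇒isGroupMonomorphism hom trivial = record
      { isGroupHomomorphism = hom
      ; injective = λ {x} {y} ψx≈ψy → GroupProperties.x∙y⁻¹≈ε⇒x≈y H x y (trivial (begin
          ψ (x H.∙ y H.⁻¹)        ≈⟨ homo x (y H.⁻¹) ⟩
          ψ x G.∙ ψ (y H.⁻¹)      ≈⟨ G.∙-congˡ (⁻¹-homo y) ⟩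
          ψ x G.∙ ψ y G.⁻¹        ≈⟨ x≈y⇒x∙y⁻¹≈ε ψx≈ψy ⟩
          G.ε                     ∎))
      }
      where open IsGroupHomomorphism hom

    -- The image of a homomorphism is a subgroup, so it is everything once it contains a generating
    -- set.
    image-of-generators⇒onto :
      IsGroupHomomorphism ψ → {S : Pred G.Carrier p} → Generates G S →
      (∀ {x} → x ∈ S → ∃[ h ] ψ h G.≈ x) → ∀ x → ∃[ h ] ψ h G.≈ x
    image-of-generators⇒onto hom {S} generates onto-S x = onto (generates x)
      where
      open IsGroupHomomorphism hom

      onto : ∀ {x} → x ∈ Generated G S → ∃[ h ] ψ h G.≈ x
      onto (generator x∈S) = onto-S x∈S
      onto identity∈       = H.ε , ε-homo
      onto (product∈ x∈ y∈) with h , ψh≈x ← onto x∈ | k , ψk≈y ← onto y∈ =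
        h H.∙ k , G.trans (homo h k) (G.∙-cong ψh≈x ψk≈y)
      onto (inverse∈ x∈)   with h , ψh≈x ← onto x∈ =
        h H.⁻¹ , G.trans (⁻¹-homo h) (G.⁻¹-cong ψh≈x)
      onto (respects x≈y x∈) with h , ψh≈x ← onto x∈ = h , G.trans ψh≈x x≈y

module _ {G : Group c ℓ} {H : Group c′ ℓ′} where
  private
    module G = Group G
    module H = Group H
  open GroupMorphisms H.rawGroup G.rawGroup
  open import Relation.Binary.Reasoning.Setoid G.setoid

  -- The natural maps run from a concrete group into G, such as i ↦ aⁱ, against the direction of
  -- `G ≅ H`. Their inverse picks preimages, and injectivity of ψ makes this choice respect equality
  -- and products.
  inverse-≅ : ∀ {ψ} → IsGroupMonomorphism ψ → (∀ x → ∃[ h ] ψ h G.≈ x) → G ≅ H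
  inverse-≅ {ψ} mono onto = φ , record
    { isGroupMonomorphism = record
      { isGroupHomomorphism = ∙-homo⇒isGroupHomomorphism {G = H} {H = G}
          (λ {x} {y} x≈y → injective (G.trans (ψφ x) (G.trans x≈y (G.sym (ψφ y)))))
          (λ x y → injective (begin
            ψ (φ (x G.∙ y))        ≈⟨ ψφ (x G.∙ y) ⟩
            x G.∙ y                ≈⟨ G.∙-cong (ψφ x) (ψφ y) ⟨
            ψ (φ x) G.∙ ψ (φ y)    ≈⟨ ∙-homo (φ x) (φ y) ⟨
            ψ (φ x H.∙ φ y)        ∎))
      ; injective = λ {x} {y} φx≈φy →
          G.trans (G.sym (ψφ x)) (G.trans (⟦⟧-cong φx≈φy) (ψφ y))
      }
    ; surjective = λ h → ψ h , λ {x} x≈ψh → injective (G.trans (ψφ x) x≈ψh)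
    }
    where
    open IsGroupMonomorphism mono

    φ : G.Carrier → H.Carrier
    φ x = proj₁ (onto x)

    ψφ : ∀ x → ψ (φ x) G.≈ x
    ψφ x = proj₂ (onto x)

≅-sym : ∀ {G : Group c ℓ} {H : Group c′ ℓ′} → G ≅ H → H ≅ G
≅-sym {G = G} {H = H} (φ , iso) = inverse-≅ {G = H} {H = G} isGroupMonomorphism
  (λ y → proj₁ (surjective y) , proj₂ (surjective y) (Group.refl G))
  where
  open GroupMorphisms (Group.rawGroup G) (Group.rawGroup H)
  open IsGroupIsomorphism iso

≅-trans : ∀ {c″ ℓ″} {G : Group c ℓ} {H : Group c′ ℓ′} {K : Group c″ ℓ″} → G ≅ H → H ≅ K → G ≅ K
≅-trans {K = K} (φ , isoφ) (χ , isoχ) =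
  χ ∘ φ , MorphismComposition.isGroupIsomorphism (Group.trans K) isoφ isoχ

-- Cyclic and dihedral groups

module _ (m : ℕ) where
  open Setoid (ℤ/-setoid m)

  <-residue-unique : ∀ {i j} → i ℕ.< m → j ℕ.< m → + i ≈ + j → i ≡ j
  <-residue-unique {i} {j} i<m j<m i≈j =
    ℤ.+-injective (ℤ.i-j≡0⇒i≡j (+ i) (+ j) (∣i∣<m∧m∣i⇒i≡0 ∣i-j∣<m i≈j))
    where
    ∣i-j∣<m : ℤ.∣ + i - + j ∣ ℕ.< m
    ∣i-j∣<m = ≡.subst (λ z → ℤ.∣ z ∣ ℕ.< m) (≡.sym (ℤ.m-n≡m⊖n i j))
      (ℕ.≤-<-trans (ℤ.∣m⊝n∣≤m⊔n i j) (ℕ.⊔-lub i<m j<m))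

module _ (m : ℕ) .{{_ : ℕ.NonZero m}} where
  open Setoid (ℤ/-setoid m)

  %ℕ-≈ : ∀ z → + (z %ℕ m) ≈ z
  %ℕ-≈ z = divides (ℤ.- (z /ℕ m)) (≡.trans (cong (+ (z %ℕ m) -_) (a≡a%ℕn+[a/ℕn]*n z m))
                                           (eq (+ (z %ℕ m)) (z /ℕ m) (+ m)))
    where
    eq : ∀ r q d → r - (r ℤ.+ q ℤ.* d) ≡ ℤ.- q ℤ.* d
    eq = solve-∀

  %ℕ-cong : ∀ {i j} → i ≈ j → i %ℕ m ≡ j %ℕ m
  %ℕ-cong {i} {j} i≈j = <-residue-unique m (n%ℕd<d i m) (n%ℕd<d j m)
    (trans {+ (i %ℕ m)} {i} {+ (j %ℕ m)} (%ℕ-≈ i)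
      (trans {i} {j} {+ (j %ℕ m)} i≈j (sym {+ (j %ℕ m)} {j} (%ℕ-≈ j))))

  ℤ/-cardinality : Group.setoid (ℤ/ m) HasCardinality m
  ℤ/-cardinality = record
    { to        = λ i → + toℕ i
    ; from      = λ z → Fin.fromℕ< (n%ℕd<d z m)
    ; to-cong   = λ { {i} ≡.refl → refl {+ toℕ i} }
    ; from-cong = λ {i} {j} i≈j → Fin.fromℕ<-cong _ _ (%ℕ-cong {i} {j} i≈j) _ _
    ; inverse   = (λ { {z} ≡.refl → ≡.subst (λ r → + r ≈ z) (≡.sym (Fin.toℕ-fromℕ< _)) (%ℕ-≈ z) })
                , (λ {i} {z} z≈i → Fin.toℕ-injective (≡.trans (Fin.toℕ-fromℕ< _)
                    (<-residue-unique m (n%ℕd<d z m) (Fin.toℕ<n i)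
                      (trans {+ (z %ℕ m)} {z} {+ toℕ i} (%ℕ-≈ z) z≈i))))
    }

  Sign-cardinality : ≡.setoid Sign HasCardinality 2
  Sign-cardinality = mk↔ₛ′ (λ { 0F → Sign.+ ; 1F → Sign.- }) (λ { Sign.+ → 0F ; Sign.- → 1F })
    (λ { Sign.+ → ≡.refl ; Sign.- → ≡.refl }) (λ { 0F → ≡.refl ; 1F → ≡.refl })

  Dihedral-cardinality : Group.setoid (Dihedral m) HasCardinality (m ℕ.* 2)
  Dihedral-cardinality =
    Composition.inverse Fin.*↔×
      (Composition.inverse (Symmetry.inverse Pointwise-≡↔≡) (ℤ/-cardinality ×-inverse Sign-cardinality))

module _ (G : Group c ℓ) where
  open Group G hiding (_-_)
  open GroupProperties G
  open Powers G
  open import Relation.Binary.Reasoning.Setoid setoid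

  module CyclicSubgroup {a d} (order : HasOrder a d) where
    open GroupMorphisms (Group.rawGroup (ℤ/ d)) rawGroup

    power-cong : ∀ {i j} → + d ∣ i - j → a ^ i ≈ a ^ j
    power-cong {i} {j} d∣i-j = x∙y⁻¹≈ε⇒x≈y _ _ (begin
      a ^ i ∙ (a ^ j) ⁻¹        ≈⟨ ∙-congˡ (^-neg a j) ⟨
      a ^ i ∙ a ^ (ℤ.- j)       ≈⟨ ^-homo-+ a i (ℤ.- j) ⟨
      a ^ (i - j)               ≈⟨ Equivalence.from (order (i - j)) d∣i-j ⟩
      ε                         ∎)

    power-isGroupMonomorphism : IsGroupMonomorphism (a ^_)
    power-isGroupMonomorphism = trivial-kernel⇒isGroupMonomorphism
      {G = G} {H = ℤ/ d}
      (∙-homo⇒isGroupHomomorphism {G = G} {H = ℤ/ d} (λ {i} {j} → power-cong {i} {j}) (^-homo-+ a))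
      (λ {z} aᶻ≈ε → ≡.subst (+ d ∣_) (≡.sym (ℤ.+-identityʳ z)) (Equivalence.to (order z) aᶻ≈ε))

  module InvolutionPair {a b d} (a²≈ε : a ∙ a ≈ ε) (b²≈ε : b ∙ b ≈ ε) (a≉ε : ¬ a ≈ ε) (b≉ε : ¬ b ≈ ε)
                        (order : HasOrder (b ∙ a) d) where
    open GroupMorphisms (Group.rawGroup (Dihedral d)) rawGroup
    open CyclicSubgroup order using (power-cong)

    r : Carrier
    r = b ∙ a

    reflect : Sign → Carrier
    reflect Sign.+ = ε
    reflect Sign.- = a

    -- The reflection f of the dihedral group becomes a, and rf becomes b because ba·a = b.
    embed : ℤ × Sign → Carrier
    embed (i , s) = r ^ i ∙ reflect s

    -- Involutions are their own inverses, so ab = a⁻¹b⁻¹ = (ba)⁻¹.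
    ar≈r⁻¹a : a ∙ r ≈ r ⁻¹ ∙ a
    ar≈r⁻¹a = begin
      a ∙ (b ∙ a)        ≈⟨ assoc a b a ⟨
      a ∙ b ∙ a          ≈⟨ ∙-congʳ (∙-cong (inverseˡ-unique a a a²≈ε) (inverseˡ-unique b b b²≈ε)) ⟩
      a ⁻¹ ∙ b ⁻¹ ∙ a    ≈⟨ ∙-congʳ (⁻¹-anti-homo-∙ b a) ⟨
      r ⁻¹ ∙ a           ∎

    arⁱ≈r⁻ⁱa : ∀ i → a ∙ r ^ i ≈ r ^ (ℤ.- i) ∙ a
    arⁱ≈r⁻ⁱa i = trans (^-intertwine ar≈r⁻¹a i) (∙-congʳ (⁻¹-^ r i))

    reflect-rotate : ∀ s i → reflect s ∙ r ^ i ≈ r ^ (⟦ s ⟧ ℤ.* i) ∙ reflect s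
    reflect-rotate Sign.+ i = begin
      ε ∙ r ^ i             ≈⟨ identityˡ _ ⟩
      r ^ i                 ≈⟨ ^-congʳ r (ℤ.*-identityˡ i) ⟨
      r ^ (ℤ.1ℤ ℤ.* i)      ≈⟨ identityʳ _ ⟨
      r ^ (ℤ.1ℤ ℤ.* i) ∙ ε  ∎
    reflect-rotate Sign.- i = trans (arⁱ≈r⁻ⁱa i) (∙-congʳ (^-congʳ r (≡.sym (ℤ.-1*i≡-i i))))

    reflect-homo : ∀ s t → reflect (s Sign.* t) ≈ reflect s ∙ reflect t
    reflect-homo Sign.+ t      = sym (identityˡ _)
    reflect-homo Sign.- Sign.+ = sym (identityʳ _)
    reflect-homo Sign.- Sign.- = sym a²≈ε

    embed-homo : ∀ x y → embed (Group._∙_ (Dihedral d) x y) ≈ embed x ∙ embed y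
    embed-homo (i , s) (j , t) = begin
      r ^ (i ℤ.+ ⟦ s ⟧ ℤ.* j) ∙ reflect (s Sign.* t)
        ≈⟨ ∙-cong (^-homo-+ r i (⟦ s ⟧ ℤ.* j)) (reflect-homo s t) ⟩
      r ^ i ∙ r ^ (⟦ s ⟧ ℤ.* j) ∙ (reflect s ∙ reflect t)
        ≈⟨ assoc _ _ _ ⟨
      r ^ i ∙ r ^ (⟦ s ⟧ ℤ.* j) ∙ reflect s ∙ reflect t
        ≈⟨ ∙-congʳ (assoc _ _ _) ⟩
      r ^ i ∙ (r ^ (⟦ s ⟧ ℤ.* j) ∙ reflect s) ∙ reflect t
        ≈⟨ ∙-congʳ (∙-congˡ (reflect-rotate s j)) ⟨
      r ^ i ∙ (reflect s ∙ r ^ j) ∙ reflect t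
        ≈⟨ ∙-congʳ (assoc _ _ _) ⟨
      r ^ i ∙ reflect s ∙ r ^ j ∙ reflect t
        ≈⟨ assoc _ _ _ ⟩
      r ^ i ∙ reflect s ∙ (r ^ j ∙ reflect t)
        ∎

    -- If a were a power of r, then r = ara⁻¹ = r⁻¹, so a would be ε or r.
    a∉⟨r⟩ : ∀ i → ¬ r ^ i ≈ a
    a∉⟨r⟩ i rⁱ≈a = absurd (even∨odd i)
      where
      r²≈ε : r ∙ r ≈ ε
      r²≈ε = begin
        r ∙ r       ≈⟨ ∙-congˡ (∙-cancelʳ a r (r ⁻¹) (begin
          r ∙ a       ≈⟨ ∙-congˡ rⁱ≈a ⟨
          r ∙ r ^ i   ≈⟨ ^-intertwine refl i ⟩
          r ^ i ∙ r   ≈⟨ ∙-congʳ rⁱ≈a ⟩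
          a ∙ r       ≈⟨ ar≈r⁻¹a ⟩
          r ⁻¹ ∙ a    ∎)) ⟩
        r ∙ r ⁻¹    ≈⟨ inverseʳ r ⟩
        ε           ∎

      even-power : ∀ q → r ^ (q ℤ.* + 2) ≈ ε
      even-power q = begin
        r ^ (q ℤ.* + 2)   ≈⟨ ^-* r q (+ 2) ⟩
        (r ^ (+ 2)) ^ q   ≈⟨ ^-cong q (trans (∙-congˡ (identityʳ r)) r²≈ε) ⟩
        ε ^ q             ≈⟨ ε-^ q ⟩
        ε                 ∎

      absurd : (∃[ q ] i ≡ q ℤ.* + 2) ⊎ (∃[ q ] i ≡ ℤ.1ℤ ℤ.+ q ℤ.* + 2) → ⊥
      absurd (inj₁ (q , ≡.refl)) = a≉ε (trans (sym rⁱ≈a) (even-power q))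
      -- An odd exponent gives ba = a, and cancelling a leaves b = ε.
      absurd (inj₂ (q , ≡.refl)) = b≉ε (identityˡ-unique b a (begin
        r                            ≈⟨ identityʳ r ⟨
        r ∙ ε                        ≈⟨ ∙-congˡ (even-power q) ⟨
        r ∙ r ^ (q ℤ.* + 2)          ≈⟨ ^-suc r (q ℤ.* + 2) ⟨
        r ^ (ℤ.1ℤ ℤ.+ q ℤ.* + 2)     ≈⟨ rⁱ≈a ⟩
        a                            ∎))

    -- For rotations this is the order of r. A reflection in the kernel would give rⁱ = a⁻¹ = a,
    -- which `a∉⟨r⟩` excludes.
    trivial-kernel : ∀ {x} → embed x ≈ ε → Group._≈_ (Dihedral d) x (Group.ε (Dihedral d))
    trivial-kernel {i , Sign.+} rⁱε≈ε =
      ≡.subst (+ d ∣_) (≡.sym (ℤ.+-identityʳ i))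
        (Equivalence.to (order i) (trans (sym (identityʳ _)) rⁱε≈ε)) , ≡.refl
    trivial-kernel {i , Sign.-} rⁱa≈ε =
      ⊥-elim (a∉⟨r⟩ i (trans (inverseˡ-unique _ _ rⁱa≈ε) (sym (inverseˡ-unique a a a²≈ε))))

    embed-isGroupMonomorphism : IsGroupMonomorphism embed
    embed-isGroupMonomorphism = trivial-kernel⇒isGroupMonomorphism {G = G} {H = Dihedral d}
      (∙-homo⇒isGroupHomomorphism {G = G} {H = Dihedral d}
        (λ { {i , s} {j , _} (d∣i-j , ≡.refl) → ∙-congʳ (power-cong {i} {j} d∣i-j) }) embed-homo)
      (λ {x} → trivial-kernel {x})

    embed-a : embed (ℤ.0ℤ , Sign.-) ≈ a
    embed-a = identityˡ a

    embed-b : embed (ℤ.1ℤ , Sign.-) ≈ b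
    embed-b = begin
      b ∙ a ∙ ε ∙ a    ≈⟨ ∙-congʳ (identityʳ _) ⟩
      b ∙ a ∙ a        ≈⟨ assoc b a a ⟩
      b ∙ (a ∙ a)      ≈⟨ ∙-congˡ a²≈ε ⟩
      b ∙ ε            ≈⟨ identityʳ b ⟩
      b                ∎

-- The symmetric group on three letters

module S₃≅Dihedral₃ where
  S₃ : Group _ _
  S₃ = Symmetric-group 3

  open Group S₃
  open Powers S₃
  a b : Carrier
  a = Perm.transpose 0F 1F
  b = Perm.transpose 1F 2F

  a²≈ε : a ∙ a ≈ ε
  a²≈ε = λ { 0F → ≡.refl ; 1F → ≡.refl ; 2F → ≡.refl }

  b²≈ε : b ∙ b ≈ ε
  b²≈ε = λ { 0F → ≡.refl ; 1F → ≡.refl ; 2F → ≡.refl }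

  a≉ε : ¬ a ≈ ε
  a≉ε a≈ε = contradiction (a≈ε 0F) λ ()

  b≉ε : ¬ b ≈ ε
  b≉ε b≈ε = contradiction (b≈ε 1F) λ ()

  order : HasOrder (b ∙ a) 3
  order = least-period⇒order (b ∙ a) 2 (λ { 0F → ≡.refl ; 1F → ≡.refl ; 2F → ≡.refl }) minimal
    where
    minimal : ∀ {k} → k ℕ.< 2 → ¬ (b ∙ a) ^ (+ suc k) ≈ ε
    minimal {0}           _              r≈ε  = contradiction (r≈ε 0F) λ ()
    minimal {1}           _              r²≈ε = contradiction (r²≈ε 0F) λ ()
    minimal {suc (suc _)} (s≤s (s≤s ()))

  open InvolutionPair S₃ {a} {b} {3} a²≈ε b²≈ε a≉ε b≉ε order

  Maps : Fin 3 → Fin 3 → Fin 3 → ℤ × Sign → Set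
  Maps x y z h = embed h ⟨$⟩ʳ 0F ≡ x × embed h ⟨$⟩ʳ 1F ≡ y × embed h ⟨$⟩ʳ 2F ≡ z

  maps? : ∀ x y z h → Dec (Maps x y z h)
  maps? x y z h = embed h ⟨$⟩ʳ 0F Fin.≟ x ×-dec embed h ⟨$⟩ʳ 1F Fin.≟ y ×-dec embed h ⟨$⟩ʳ 2F Fin.≟ z

  -- Formulated for arbitrary triples of values instead of permutations, so that the 27 cases can be
  -- settled by a decision procedure. The first three alternatives absorb the triples that no
  -- permutation produces; exponents below 3 suffice because ba is a 3-cycle.
  Realised : Fin 3 → Fin 3 → Fin 3 → Set
  Realised x y z = x ≡ y ⊎ y ≡ z ⊎ x ≡ z ⊎
    (∃[ i ] Maps x y z (+ toℕ {3} i , Sign.+)) ⊎ (∃[ i ] Maps x y z (+ toℕ {3} i , Sign.-))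

  realised? : ∀ x y z → Dec (Realised x y z)
  realised? x y z = x Fin.≟ y ⊎-dec y Fin.≟ z ⊎-dec x Fin.≟ z ⊎-dec
    Fin.any? (λ i → maps? x y z (+ toℕ i , Sign.+)) ⊎-dec
    Fin.any? (λ i → maps? x y z (+ toℕ i , Sign.-))

  all-realised : ∀ x y z → Realised x y z
  all-realised = from-yes (Fin.all? λ x → Fin.all? λ y → Fin.all? λ z → realised? x y z)

  embed-onto : ∀ π → ∃[ h ] embed h ≈ π
  embed-onto π = found (all-realised (π ⟨$⟩ʳ 0F) (π ⟨$⟩ʳ 1F) (π ⟨$⟩ʳ 2F))
    where
    pointwise : ∀ h → Maps (π ⟨$⟩ʳ 0F) (π ⟨$⟩ʳ 1F) (π ⟨$⟩ʳ 2F) h → embed h ≈ π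
    pointwise _ (eq , _ , _) 0F = eq
    pointwise _ (_ , eq , _) 1F = eq
    pointwise _ (_ , _ , eq) 2F = eq

    injective : ∀ {i j} → π ⟨$⟩ʳ i ≡ π ⟨$⟩ʳ j → i ≡ j
    injective = Injection.injective (Inverse⇒Injection π)

    found : Realised (π ⟨$⟩ʳ 0F) (π ⟨$⟩ʳ 1F) (π ⟨$⟩ʳ 2F) → ∃[ h ] embed h ≈ π
    found (inj₁ π0≡π1)                             = contradiction (injective π0≡π1) λ ()
    found (inj₂ (inj₁ π1≡π2))                      = contradiction (injective π1≡π2) λ ()
    found (inj₂ (inj₂ (inj₁ π0≡π2)))               = contradiction (injective π0≡π2) λ ()
    found (inj₂ (inj₂ (inj₂ (inj₁ (i , maps)))))   = (+ toℕ i , Sign.+) , pointwise (+ toℕ i , Sign.+) maps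
    found (inj₂ (inj₂ (inj₂ (inj₂ (i , maps)))))   = (+ toℕ i , Sign.-) , pointwise (+ toℕ i , Sign.-) maps

  iso : S₃ ≅ Dihedral 3
  iso = inverse-≅ {G = S₃} {H = Dihedral 3} embed-isGroupMonomorphism embed-onto

open S₃≅Dihedral₃ public using () renaming (iso to S₃≅Dihedral₃)

-- A parametrisation of the vertices by ℤ/n that carries the Cayley graph of
-- {a , b} to the cycle of length n.
record CyclicPosition (G : Group c ℓ) (a b : Group.Carrier G) (n : ℕ) : Set (c ⊔ ℓ) where
  open Group G hiding (_-_)
  open Setoid (ℤ/-setoid n) using () renaming (_≈_ to _≈ₙ_)
  field
    pos        : Carrier → ℤ
    pos-cong   : ∀ {x y} → x ≈ y → pos x ≈ₙ pos y
    pos-onto   : ∀ i → ∃[ x ] pos x ≈ₙ i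
    -- The orientation may depend on x, as it does in the dihedral group.
    neighbours : ∀ x →
      (pos (a ∙ x) ≈ₙ pos x ℤ.+ ℤ.1ℤ × pos (b ∙ x) ≈ₙ pos x ℤ.+ ℤ.-1ℤ) ⊎
      (pos (a ∙ x) ≈ₙ pos x ℤ.+ ℤ.-1ℤ × pos (b ∙ x) ≈ₙ pos x ℤ.+ ℤ.1ℤ)

pullback : ∀ {G : Group c ℓ} {H : Group c′ ℓ′} {n a b α β} ((φ , _) : G ≅ H) →
           Group._≈_ H (φ a) α → Group._≈_ H (φ b) β →
           CyclicPosition H α β n → CyclicPosition G a b n
pullback {G = G} {H = H} {n} {a} {b} {α} {β} (φ , iso) φa≈α φb≈β position = record
  { pos        = λ x → pos (φ x)
  ; pos-cong   = λ x≈y → pos-cong (⟦⟧-cong x≈y)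
  ; pos-onto   = onto
  ; neighbours = λ x → Sum.map (Product.map (step φa≈α) (step φb≈β))
                               (Product.map (step φa≈α) (step φb≈β)) (neighbours (φ x))
  }
  where
  module G = Group G
  module H = Group H
  module Z = Setoid (ℤ/-setoid n)
  open GroupMorphisms G.rawGroup H.rawGroup
  open IsGroupIsomorphism iso
  open CyclicPosition position

  onto : ∀ i → ∃[ x ] pos (φ x) Z.≈ i
  onto i with y , pos[y]≈i ← pos-onto i with x , φx≈y ← surjective y =
    x , Z.trans {pos (φ x)} {pos y} {i} (pos-cong (φx≈y G.refl)) pos[y]≈i

  step : ∀ {s σ x j} → φ s H.≈ σ → pos (σ H.∙ φ x) Z.≈ j → pos (φ (s G.∙ x)) Z.≈ j
  step {s} {σ} {x} {j} φs≈σ = Z.trans {pos (φ (s G.∙ x))} {pos (σ H.∙ φ x)} {j}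
    (pos-cong (H.trans (∙-homo s x) (H.∙-congʳ φs≈σ)))

ℤ/-position : ∀ n → CyclicPosition (ℤ/ n) ℤ.1ℤ ℤ.-1ℤ n
ℤ/-position n = record
  { pos        = λ i → i
  ; pos-cong   = λ i≈j → i≈j
  ; pos-onto   = λ i → i , Z.refl {i}
  ; neighbours = λ i → inj₁ (Z.reflexive (ℤ.+-comm ℤ.1ℤ i) , Z.reflexive (ℤ.+-comm ℤ.-1ℤ i))
  }
  where module Z = Setoid (ℤ/-setoid n)

-- Multiplying on the left alternately by f and rf visits
-- 1, f, r, r⁻¹f, r², r⁻²f, …
Dihedral-position : ∀ d → CyclicPosition (Dihedral d) (ℤ.0ℤ , Sign.-) (ℤ.1ℤ , Sign.-) (d ℕ.* 2)
Dihedral-position d = record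
  { pos        = pos
  ; pos-cong   = λ { {i , Sign.+} {j , _} (d∣i-j , ≡.refl) →
                       ≡.subst (+ (d ℕ.* 2) ∣_) (distrib⁺ i j) (doubled d∣i-j)
                   ; {i , Sign.-} {j , _} (d∣i-j , ≡.refl) →
                       ≡.subst (+ (d ℕ.* 2) ∣_) (distrib⁻ i j) (∣m⇒∣-m (doubled d∣i-j)) }
  ; pos-onto   = onto
  ; neighbours = λ { (i , Sign.+) → inj₁ (Z.reflexive (a⁺ i) , Z.reflexive (b⁺ i))
                   ; (i , Sign.-) → inj₂ (Z.reflexive (a⁻ i) , Z.reflexive (b⁻ i)) }
  }
  where
  module Z = Setoid (ℤ/-setoid (d ℕ.* 2))

  -- Rotations take the even positions and reflections the odd ones. Reflections carry decreasing
  -- exponents because f inverts r; doubling turns exponents modulo d into positions modulo 2d.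
  pos : ℤ × Sign → ℤ
  pos (i , Sign.+) = i ℤ.* + 2
  pos (i , Sign.-) = ℤ.1ℤ - i ℤ.* + 2

  doubled : ∀ {z} → + d ∣ z → + (d ℕ.* 2) ∣ z ℤ.* + 2
  doubled {z} d∣z = ≡.subst (_∣ z ℤ.* + 2) (≡.sym (ℤ.pos-* d 2)) (*-monoˡ-∣ (+ 2) d∣z)

  distrib⁺ : ∀ i j → (i - j) ℤ.* + 2 ≡ i ℤ.* + 2 - j ℤ.* + 2
  distrib⁺ = solve-∀

  distrib⁻ : ∀ i j → ℤ.- ((i - j) ℤ.* + 2) ≡ (ℤ.1ℤ - i ℤ.* + 2) - (ℤ.1ℤ - j ℤ.* + 2)
  distrib⁻ = solve-∀

  onto : ∀ i → ∃[ x ] pos x Z.≈ i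
  onto i with even∨odd i
  ... | inj₁ (q , ≡.refl) = (q , Sign.+) , Z.refl {i}
  ... | inj₂ (q , ≡.refl) = (ℤ.- q , Sign.-) , Z.reflexive (eq q)
    where
    eq : ∀ q → ℤ.1ℤ - ℤ.- q ℤ.* + 2 ≡ ℤ.1ℤ ℤ.+ q ℤ.* + 2
    eq = solve-∀

  a⁺ : ∀ i → ℤ.1ℤ - (ℤ.0ℤ ℤ.+ ℤ.-1ℤ ℤ.* i) ℤ.* + 2 ≡ i ℤ.* + 2 ℤ.+ ℤ.1ℤ
  a⁺ = solve-∀

  b⁺ : ∀ i → ℤ.1ℤ - (ℤ.1ℤ ℤ.+ ℤ.-1ℤ ℤ.* i) ℤ.* + 2 ≡ i ℤ.* + 2 ℤ.+ ℤ.-1ℤ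
  b⁺ = solve-∀

  a⁻ : ∀ i → (ℤ.0ℤ ℤ.+ ℤ.-1ℤ ℤ.* i) ℤ.* + 2 ≡ (ℤ.1ℤ - i ℤ.* + 2) ℤ.+ ℤ.-1ℤ
  a⁻ = solve-∀

  b⁻ : ∀ i → (ℤ.1ℤ ℤ.+ ℤ.-1ℤ ℤ.* i) ℤ.* + 2 ≡ (ℤ.1ℤ - i ℤ.* + 2) ℤ.+ ℤ.1ℤ
  b⁻ = solve-∀

-- Classification of the groups generated by an inverse-closed pair

CycleGroup : (G : Group c ℓ) → ℕ → Set (c ⊔ ℓ)
CycleGroup G n = G ≅ ℤ/ n ⊎ (∃[ d ] n ≡ d ℕ.* 2 × G ≅ Dihedral d)

module _ (G : Group c ℓ) {n} (|G|≡n : Group.setoid G HasCardinality n) where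
  open Group G hiding (_-_)
  open GroupProperties G
  open Powers G

  module _ {S : Pred Carrier p} (generates : Generates G S) {a b : Carrier}
           (S⊆ab : ∀ {x} → x ∈ S → x ≈ a ⊎ x ≈ b) where

    -- Here a alone generates G, so G is cyclic of the order of a, and comparing cardinalities
    -- identifies that order with n. Positions are logarithms to the base a.
    inverse-pair : ∀ {m} → HasOrder a (suc m) → b ≈ a ⁻¹ → G ≅ ℤ/ n × CyclicPosition G a b n
    inverse-pair {m} order b≈a⁻¹ = ≡.subst (λ k → G ≅ ℤ/ k × CyclicPosition G a b k) d≡n
      (iso , pullback {G = G} {H = H} iso (log ℤ.1ℤ (identityʳ a)) (log ℤ.-1ℤ a^-1≈b)
        (ℤ/-position (suc m)))
      where
      H = ℤ/ (suc m)
      open CyclicSubgroup G order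
      open GroupMorphisms.IsGroupMonomorphism power-isGroupMonomorphism

      a^-1≈b : a ^ ℤ.-1ℤ ≈ b
      a^-1≈b = trans (identityʳ _) (sym b≈a⁻¹)

      onto : ∀ x → ∃[ i ] a ^ i ≈ x
      onto = image-of-generators⇒onto {G = G} {H = H} isGroupHomomorphism generates λ x∈S →
        case S⊆ab x∈S of λ where
        (inj₁ x≈a) → ℤ.1ℤ , trans (identityʳ a) (sym x≈a)
        (inj₂ x≈b) → ℤ.-1ℤ , trans a^-1≈b (sym x≈b)

      iso : G ≅ H
      iso = inverse-≅ {G = G} {H = H} power-isGroupMonomorphism onto

      -- The isomorphism is made of chosen preimages, so its value at a generator is known only
      -- through injectivity of the powers of a.
      log : ∀ {x} i → a ^ i ≈ x → Group._≈_ H (proj₁ iso x) i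
      log {x} i aⁱ≈x = injective {proj₁ iso x} {i} (trans (proj₂ (onto x)) (sym aⁱ≈x))

      d≡n : suc m ≡ n
      d≡n = HasCardinality-unique (≅-cardinality {G = G} {H = H} iso (ℤ/-cardinality (suc m))) |G|≡n

    involution-pair : ∀ {m} → HasOrder (b ∙ a) (suc m) → a ∙ a ≈ ε → b ∙ b ≈ ε → ¬ a ≈ ε → ¬ b ≈ ε →
                      (∃[ d ] n ≡ d ℕ.* 2 × G ≅ Dihedral d) × CyclicPosition G a b n
    involution-pair {m} order a²≈ε b²≈ε a≉ε b≉ε =
      (suc m , n≡2d , iso) , ≡.subst (CyclicPosition G a b) (≡.sym n≡2d)
        (pullback {G = G} {H = H} iso (log (ℤ.0ℤ , Sign.-) embed-a) (log (ℤ.1ℤ , Sign.-) embed-b)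
          (Dihedral-position (suc m)))
      where
      H = Dihedral (suc m)
      open InvolutionPair G a²≈ε b²≈ε a≉ε b≉ε order
      open GroupMorphisms.IsGroupMonomorphism embed-isGroupMonomorphism

      onto : ∀ x → ∃[ h ] embed h ≈ x
      onto = image-of-generators⇒onto {G = G} {H = H} isGroupHomomorphism generates λ x∈S →
        case S⊆ab x∈S of λ where
        (inj₁ x≈a) → (ℤ.0ℤ , Sign.-) , trans embed-a (sym x≈a)
        (inj₂ x≈b) → (ℤ.1ℤ , Sign.-) , trans embed-b (sym x≈b)

      iso : G ≅ H
      iso = inverse-≅ {G = G} {H = H} embed-isGroupMonomorphism onto

      log : ∀ {x} h → embed h ≈ x → Group._≈_ H (proj₁ iso x) h
      log {x} h eq = injective {proj₁ iso x} {h} (trans (proj₂ (onto x)) (sym eq))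

      n≡2d : n ≡ suc m ℕ.* 2
      n≡2d = HasCardinality-unique |G|≡n (≅-cardinality {G = G} {H = H} iso (Dihedral-cardinality (suc m)))

    -- Inversion permutes {a , b}: either it swaps the two, or it fixes both and they are
    -- involutions. Sending both to a would contradict its injectivity.
    cycle : a ⁻¹ ∈ S → b ⁻¹ ∈ S → ¬ a ≈ b → ¬ a ≈ ε → ¬ b ≈ ε →
            CycleGroup G n × CyclicPosition G a b n
    cycle a⁻¹∈S b⁻¹∈S a≉b a≉ε b≉ε with S⊆ab a⁻¹∈S | S⊆ab b⁻¹∈S
    ... | inj₂ a⁻¹≈b | _           = Product.map₁ inj₁ (inverse-pair (proj₂ (finite-order |G|≡n a)) (sym a⁻¹≈b))
    ... | inj₁ a⁻¹≈a | inj₁ b⁻¹≈a  = ⊥-elim (a≉b (⁻¹-injective (trans a⁻¹≈a (sym b⁻¹≈a))))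
    ... | inj₁ a⁻¹≈a | inj₂ b⁻¹≈b  = Product.map₁ inj₂ (involution-pair
      (proj₂ (finite-order |G|≡n (b ∙ a))) (involution a⁻¹≈a) (involution b⁻¹≈b) a≉ε b≉ε)
      where
      involution : ∀ {x} → x ⁻¹ ≈ x → x ∙ x ≈ ε
      involution {x} x⁻¹≈x = trans (∙-congʳ (sym x⁻¹≈x)) (inverseˡ x)

-- Signed domination of the Cayley graph

module CayleyCycle {c ℓ p} (G : Group c ℓ) {n : ℕ} (|G|≡n : Group.setoid G HasCardinality n)
  (S : Pred (Group.Carrier G) p) (S-resp : S Respects Group._≈_ G) (ε∉S : Group.ε G ∉ S)
  (S≐S⁻¹ : S ≐ InverseSet G S) (generates : Generates G S)
  (|S|≡2 : Subsetoid (Group.setoid G) S HasCardinality 2) where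

  open Group G hiding (_-_)
  open GroupProperties G

  Γ : FiniteSimpleGraph _ _ _
  Γ = Cay G S S-resp |G|≡n |S|≡2 ε∉S S≐S⁻¹

  open FiniteSimpleGraph Γ using (∑N[_])
  open Inverse |G|≡n using () renaming (to to vertex)

  _≟_ : ∀ x y → Dec (x ≈ y)
  _≟_ = _≈?_ setoid |G|≡n

  a b : Carrier
  a = proj₁ (Inverse.to |S|≡2 0F)
  b = proj₁ (Inverse.to |S|≡2 1F)

  a∈S : a ∈ S
  a∈S = proj₂ (Inverse.to |S|≡2 0F)

  b∈S : b ∈ S
  b∈S = proj₂ (Inverse.to |S|≡2 1F)

  S⊆ab : ∀ {x} → x ∈ S → x ≈ a ⊎ x ≈ b
  S⊆ab {x} x∈S with Inverse.from |S|≡2 (x , x∈S) | Inverse.inverseˡ |S|≡2 {x , x∈S} ≡.refl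
  ... | 0F | a≈x = inj₁ (sym a≈x)
  ... | 1F | b≈x = inj₂ (sym b≈x)

  a≉b : ¬ a ≈ b
  a≉b a≈b = contradiction (Injection.injective (Inverse⇒Injection |S|≡2) {0F} {1F} a≈b) λ ()

  ∈S⇒≉ε : ∀ {x} → x ∈ S → ¬ x ≈ ε
  ∈S⇒≉ε x∈S x≈ε = ε∉S (S-resp x≈ε x∈S)

  ⁻¹∈S : ∀ {x} → x ∈ S → x ⁻¹ ∈ S
  ⁻¹∈S {x} x∈S = proj₂ S≐S⁻¹ (x , x∈S , refl)

  cycle-structure : CycleGroup G n × CyclicPosition G a b n
  cycle-structure = cycle G |G|≡n generates S⊆ab (⁻¹∈S a∈S) (⁻¹∈S b∈S) a≉b (∈S⇒≉ε a∈S) (∈S⇒≉ε b∈S)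

  -- N[v] consists of v, av and bv. They are distinct, since a and b differ from each other and from
  -- ε, so each value is counted once.
  ∑N≡ : ∀ {f : Carrier → ℤ} → (∀ {x y} → x ≈ y → f x ≡ f y) →
        ∀ v → ∑N[ v ] f ≡ f v ℤ.+ (f (a ∙ v) ℤ.+ f (b ∙ v))
  ∑N≡ {f} f-cong v = begin
    ∑N[ v ] f
      ≡⟨ sum-cong-≗ {n} pointwise ⟩
    sum (λ i → at v i ℤ.+ (at (a ∙ v) i ℤ.+ at (b ∙ v) i))
      ≡⟨ ∑-distrib-+ (at v) (λ i → at (a ∙ v) i ℤ.+ at (b ∙ v) i) ⟩
    sum (at v) ℤ.+ sum (λ i → at (a ∙ v) i ℤ.+ at (b ∙ v) i)
      ≡⟨ cong (λ z → sum (at v) ℤ.+ z) (∑-distrib-+ (at (a ∙ v)) (at (b ∙ v))) ⟩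
    sum (at v) ℤ.+ (sum (at (a ∙ v)) ℤ.+ sum (at (b ∙ v)))
      ≡⟨ ≡.cong₂ ℤ._+_ (indicator v) (≡.cong₂ ℤ._+_ (indicator (a ∙ v)) (indicator (b ∙ v))) ⟩
    f v ℤ.+ (f (a ∙ v) ℤ.+ f (b ∙ v))
      ∎
    where
    open ≡.≡-Reasoning
    open FiniteSimpleGraph Γ using (_∈N[_]?; adjacent?; Adjacent)

    at : Carrier → Fin n → ℤ
    at x i = if does (vertex i ≟ x) then f (vertex i) else ℤ.0ℤ

    indicator : ∀ x → sum (at x) ≡ f x
    indicator = sum-indicator setoid |G|≡n f-cong

    not-both-v-and-adjacent : ∀ {x} → ¬ (x ≈ v × Adjacent x v)
    not-both-v-and-adjacent {x} (x≈v , xv⁻¹∈S) = ∈S⇒≉ε xv⁻¹∈S (x≈y⇒x∙y⁻¹≈ε x≈v)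

    not-both-av-and-bv : ∀ {x} → ¬ (x ≈ a ∙ v × x ≈ b ∙ v)
    not-both-av-and-bv (x≈av , x≈bv) = a≉b (∙-cancelʳ v a b (trans (sym x≈av) x≈bv))

    move : ∀ {x s} → x ∙ v ⁻¹ ≈ s → x ≈ s ∙ v
    move {x} xv⁻¹≈s = trans (sym (//-rightDividesˡ v x)) (∙-congʳ xv⁻¹≈s)

    adjacent⇒ : ∀ {x} → Adjacent x v → x ≈ a ∙ v ⊎ x ≈ b ∙ v
    adjacent⇒ xv⁻¹∈S = Sum.map move move (S⊆ab xv⁻¹∈S)

    translate-adjacent : ∀ {x s} → s ∈ S → x ≈ s ∙ v → Adjacent x v
    translate-adjacent {s = s} s∈S x≈sv = S-resp (sym (trans (∙-congʳ x≈sv) (//-rightDividesʳ v s))) s∈S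

    ⇒adjacent : ∀ {x} → x ≈ a ∙ v ⊎ x ≈ b ∙ v → Adjacent x v
    ⇒adjacent = Sum.[ translate-adjacent a∈S , translate-adjacent b∈S ]

    pointwise : ∀ i → (if does (vertex i ∈N[ v ]?) then f (vertex i) else ℤ.0ℤ) ≡
                      at v i ℤ.+ (at (a ∙ v) i ℤ.+ at (b ∙ v) i)
    pointwise i = ≡.trans
      (if-⊎ (u ∈N[ v ]?) (u ≟ v) (adjacent? u v) (mk⇔ id id) not-both-v-and-adjacent (f u))
      (cong (λ z → at v i ℤ.+ z)
        (if-⊎ (adjacent? u v) (u ≟ (a ∙ v)) (u ≟ (b ∙ v)) (mk⇔ adjacent⇒ ⇒adjacent)
          not-both-av-and-bv (f u)))
      where u = vertex i

  left-translation : Carrier → Inverse setoid setoid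
  left-translation s = record
    { to        = s ∙_
    ; from      = s ⁻¹ ∙_
    ; to-cong   = ∙-congˡ
    ; from-cong = ∙-congˡ
    ; inverse   = (λ {x} y≈s⁻¹x → trans (∙-congˡ y≈s⁻¹x) (\\-leftDividesˡ s x))
                , (λ {x} y≈sx → trans (∙-congˡ y≈sx) (\\-leftDividesʳ s x))
    }

  module _ (g : Signing Γ) where
    value : Carrier → ℤ
    value x = ⟦ Func.to g x ⟧

    value-cong : ∀ {x y} → x ≈ y → value x ≡ value y
    value-cong x≈y = cong ⟦_⟧ (Func.cong g x≈y)

    -- Every vertex lies in three closed neighbourhoods.
    ∑∑N≡3*weight : sum (λ i → ∑N[ vertex i ] value) ≡ + 3 ℤ.* weight Γ g
    ∑∑N≡3*weight = begin
      sum (λ i → ∑N[ vertex i ] value)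
        ≡⟨ sum-cong-≗ {n} (λ i → ∑N≡ value-cong (vertex i)) ⟩
      sum (λ i → value (vertex i) ℤ.+ (value (a ∙ vertex i) ℤ.+ value (b ∙ vertex i)))
        ≡⟨ ∑-distrib-+ (λ i → value (vertex i)) (λ i → value (a ∙ vertex i) ℤ.+ value (b ∙ vertex i)) ⟩
      w ℤ.+ sum (λ i → value (a ∙ vertex i) ℤ.+ value (b ∙ vertex i))
        ≡⟨ cong (λ z → w ℤ.+ z) (∑-distrib-+ (λ i → value (a ∙ vertex i)) (λ i → value (b ∙ vertex i))) ⟩
      w ℤ.+ (sum (λ i → value (a ∙ vertex i)) ℤ.+ sum (λ i → value (b ∙ vertex i)))
        ≡⟨ cong (λ z → w ℤ.+ z) (≡.cong₂ ℤ._+_ (reindex a) (reindex b)) ⟩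
      w ℤ.+ (w ℤ.+ w)
        ≡⟨ eq w ⟩
      + 3 ℤ.* w
        ∎
      where
      open ≡.≡-Reasoning
      w = weight Γ g

      reindex : ∀ s → sum (λ i → value (s ∙ vertex i)) ≡ w
      reindex s = sum-reindex setoid |G|≡n value-cong (left-translation s)

      eq : ∀ w → w ℤ.+ (w ℤ.+ w) ≡ + 3 ℤ.* w
      eq = solve-∀

    weight-lower-bound : IsSignedDominating Γ g → + n - + 2 ℤ.* + (n / 3) ℤ.≤ weight Γ g
    weight-lower-bound dominating = bound (sum-signs (λ i → Func.to g (vertex i)))
      where
      -- A positive integer is at least 1, so the n neighbourhood sums add up to at least n.
      n≤3w : + n ℤ.≤ + 3 ℤ.* weight Γ g
      n≤3w = ≡.subst (+ n ℤ.≤_) ∑∑N≡3*weight (n≤sum (λ i → ℤ.i<j⇒suc[i]≤j (dominating (vertex i))))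

      bound : ∃[ k ] weight Γ g ≡ + n - + 2 ℤ.* + k → + n - + 2 ℤ.* + (n / 3) ℤ.≤ weight Γ g
      bound (k , w≡n-2k) = ≡.subst (+ n - + 2 ℤ.* + (n / 3) ℤ.≤_) (≡.sym w≡n-2k)
        (ℤ.+-monoʳ-≤ (+ n) (ℤ.neg-mono-≤ (ℤ.*-monoˡ-≤-nonNeg (+ 2) (ℤ.+≤+ k≤n/3))))
        where
        -- Adding 6k - n to both sides of n ≤ 3(n - 2k) gives 6k ≤ 2n, with no subtraction left on
        -- either side.
        eq₁ : ∀ n k → n ℤ.+ (+ 2 ℤ.* (k ℤ.* + 3) - n) ≡ + 2 ℤ.* (k ℤ.* + 3)
        eq₁ = solve-∀

        eq₂ : ∀ n k → + 3 ℤ.* (n - + 2 ℤ.* k) ℤ.+ (+ 2 ℤ.* (k ℤ.* + 3) - n) ≡ + 2 ℤ.* n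
        eq₂ = solve-∀

        2*3k≤2*n : + 2 ℤ.* (+ k ℤ.* + 3) ℤ.≤ + 2 ℤ.* + n
        2*3k≤2*n = ≡.subst₂ ℤ._≤_ (eq₁ (+ n) (+ k)) (eq₂ (+ n) (+ k))
          (ℤ.+-monoˡ-≤ _ (≡.subst (λ w → + n ℤ.≤ + 3 ℤ.* w) w≡n-2k n≤3w))

        3k≤n : k ℕ.* 3 ℕ.≤ n
        3k≤n = ℤ.drop‿+≤+ (≡.subst (ℤ._≤ + n) (≡.sym (ℤ.pos-* k 3))
          (ℤ.*-cancelˡ-≤-pos (+ k ℤ.* + 3) (+ n) (+ 2) 2*3k≤2*n))

        k≤n/3 : k ℕ.≤ n / 3
        k≤n/3 = ≡.subst (ℕ._≤ n / 3) (ℕ.m*n/n≡m k 3) (ℕ./-monoˡ-≤ 3 3k≤n)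

  module _ (position : CyclicPosition G a b n) k (3k≤n : k ℕ.* 3 ℕ.≤ n) where
    open CyclicPosition position
    private module Z = Setoid (ℤ/-setoid n)

    T : Fin k → Carrier
    T i = proj₁ (pos-onto (+ toℕ i ℤ.* + 3))

    near : ∀ {x y δ} i → x ≈ T i → pos x Z.≈ pos y ℤ.+ δ → pos y ℤ.+ δ Z.≈ + toℕ i ℤ.* + 3
    near {x} {y} {δ} i x≈Tᵢ pos[x]≈pos[y]+δ =
      Z.trans {pos y ℤ.+ δ} {pos x} {3i} (Z.sym {pos x} {pos y ℤ.+ δ} pos[x]≈pos[y]+δ)
        (Z.trans {pos x} {pos (T i)} {3i} (pos-cong x≈Tᵢ) (proj₂ (pos-onto 3i)))
      where 3i = + toℕ i ℤ.* + 3

    here : ∀ x → pos x Z.≈ pos x ℤ.+ ℤ.0ℤ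
    here x = Z.reflexive (≡.sym (ℤ.+-identityʳ (pos x)))

    -- Both offsets are 0 in the separation of multiples of 3. It ensures that the k marked vertices
    -- are distinct, so that no vertex is counted twice in the weight.
    T-injective : ∀ {i j x} → x ≈ T i → x ≈ T j → i ≡ j
    T-injective {i} {j} {x} x≈Tᵢ x≈Tⱼ = proj₁ (multiples-of-3-separated 3k≤n i j {pos x} z≤n z≤n
      (near i x≈Tᵢ (here x)) (near j x≈Tⱼ (here x)))

    ∈T : Carrier → Set ℓ
    ∈T x = ∃[ i ] x ≈ T i

    ∈T? : ∀ x → Dec (∈T x)
    ∈T? x = Fin.any? (λ i → x ≟ T i)

    separated : ∀ {x y v δ δ′} → ℤ.∣ δ ∣ ℕ.≤ 1 → ℤ.∣ δ′ ∣ ℕ.≤ 1 → δ ≢ δ′ →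
                pos x Z.≈ pos v ℤ.+ δ → pos y Z.≈ pos v ℤ.+ δ′ → ¬ (∈T x × ∈T y)
    separated {x} {y} {v} ∣δ∣≤1 ∣δ′∣≤1 δ≢δ′ pos[x] pos[y] ((i , x≈Tᵢ) , (j , y≈Tⱼ)) =
      δ≢δ′ (proj₂ (multiples-of-3-separated 3k≤n i j {pos v} ∣δ∣≤1 ∣δ′∣≤1
        (near {x} {v} i x≈Tᵢ pos[x]) (near {y} {v} j y≈Tⱼ pos[y])))

    sign : Carrier → Sign
    sign x = if does (∈T? x) then Sign.- else Sign.+

    sign-cong : ∀ {x y} → x ≈ y → sign x ≡ sign y
    sign-cong {x} {y} x≈y = cong (λ t → if t then Sign.- else Sign.+) (does-⇔
      (mk⇔ (λ (i , x≈Tᵢ) → i , trans (sym x≈y) x≈Tᵢ) (λ (i , y≈Tᵢ) → i , trans x≈y y≈Tᵢ))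
      (∈T? x) (∈T? y))

    every-third : Signing Γ
    every-third = record { to = sign ; cong = sign-cong }

    at-most-one-negative : ∀ {x y z} → ¬ (∈T x × ∈T y) → ¬ (∈T x × ∈T z) → ¬ (∈T y × ∈T z) →
                           ⟦ sign x ⟧ ℤ.+ (⟦ sign y ⟧ ℤ.+ ⟦ sign z ⟧) ℤ.> ℤ.0ℤ
    at-most-one-negative {x} {y} {z} ¬xy ¬xz ¬yz with ∈T? x | ∈T? y | ∈T? z
    ... | yes x∈ | yes y∈ | _      = contradiction (x∈ , y∈) ¬xy
    ... | yes x∈ | no _   | yes z∈ = contradiction (x∈ , z∈) ¬xz
    ... | no _   | yes y∈ | yes z∈ = contradiction (y∈ , z∈) ¬yz
    ... | yes _  | no _   | no _   = ℤ.+<+ (s≤s z≤n)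
    ... | no _   | yes _  | no _   = ℤ.+<+ (s≤s z≤n)
    ... | no _   | no _   | yes _  = ℤ.+<+ (s≤s z≤n)
    ... | no _   | no _   | no _   = ℤ.+<+ (s≤s z≤n)

    every-third-dominating : IsSignedDominating Γ every-third
    every-third-dominating v = ≡.subst (ℤ._> ℤ.0ℤ) (≡.sym (∑N≡ (λ x≈y → cong ⟦_⟧ (sign-cong x≈y)) v))
      (positive (neighbours v))
      where
      1≤1 : 1 ℕ.≤ 1
      1≤1 = ℕ.≤-refl

      -- In either orientation v, av and bv have the pairwise distinct offsets 0, 1 and -1 from v,
      -- so no two of them are marked.
      positive : _ → ⟦ sign v ⟧ ℤ.+ (⟦ sign (a ∙ v) ⟧ ℤ.+ ⟦ sign (b ∙ v) ⟧) ℤ.> ℤ.0ℤ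
      positive (inj₁ (av , bv)) = at-most-one-negative
        (separated {v = v} {δ = ℤ.0ℤ} {ℤ.1ℤ} z≤n 1≤1 (λ ()) (here v) av)
        (separated {v = v} {δ = ℤ.0ℤ} {ℤ.-1ℤ} z≤n 1≤1 (λ ()) (here v) bv)
        (separated {v = v} {δ = ℤ.1ℤ} {ℤ.-1ℤ} 1≤1 1≤1 (λ ()) av bv)
      positive (inj₂ (av , bv)) = at-most-one-negative
        (separated {v = v} {δ = ℤ.0ℤ} {ℤ.-1ℤ} z≤n 1≤1 (λ ()) (here v) av)
        (separated {v = v} {δ = ℤ.0ℤ} {ℤ.1ℤ} z≤n 1≤1 (λ ()) (here v) bv)
        (separated {v = v} {δ = ℤ.-1ℤ} {ℤ.1ℤ} 1≤1 1≤1 (λ ()) av bv)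

    -- The change from 1 to -1 is -2. Recording it separately for each marked vertex turns the
    -- weight into a double sum; after exchanging the sums, each index in `Fin k` contributes
    -- exactly one -2.
    defect : Carrier → Fin k → ℤ
    defect x i = if does (x ≟ T i) then ℤ.- + 2 else ℤ.0ℤ

    value≡1+defects : ∀ x → ⟦ sign x ⟧ ≡ ℤ.1ℤ ℤ.+ sum (defect x)
    value≡1+defects x with ∈T? x
    ... | yes (i , x≈Tᵢ) = cong (λ z → ℤ.1ℤ ℤ.+ z) (≡.sym (≡.trans
      (sum-single (defect x) i (λ j j≢i → cong (λ t → if t then ℤ.- + 2 else ℤ.0ℤ)
        (dec-false (x ≟ T j) (λ x≈Tⱼ → j≢i (T-injective x≈Tⱼ x≈Tᵢ)))))
      (cong (λ t → if t then ℤ.- + 2 else ℤ.0ℤ) (dec-true (x ≟ T i) x≈Tᵢ))))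
    ... | no x∉T = cong (λ z → ℤ.1ℤ ℤ.+ z) (≡.sym (sum-zero (λ j →
      cong (λ t → if t then ℤ.- + 2 else ℤ.0ℤ) (dec-false (x ≟ T j) (λ x≈Tⱼ → x∉T (j , x≈Tⱼ))))))

    every-third-weight : weight Γ every-third ≡ + n - + 2 ℤ.* + k
    every-third-weight = begin
      sum (λ i → ⟦ sign (vertex i) ⟧)
        ≡⟨ sum-cong-≗ {n} (λ i → value≡1+defects (vertex i)) ⟩
      sum (λ i → ℤ.1ℤ ℤ.+ sum (defect (vertex i)))
        ≡⟨ ∑-distrib-+ {n} (λ _ → ℤ.1ℤ) (λ i → sum (defect (vertex i))) ⟩
      sum {n} (λ _ → ℤ.1ℤ) ℤ.+ sum (λ i → sum (defect (vertex i)))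
        ≡⟨ ≡.cong₂ ℤ._+_ (sum-const n ℤ.1ℤ) (∑-comm (λ i → defect (vertex i))) ⟩
      + n ℤ.* ℤ.1ℤ ℤ.+ sum (λ j → sum (λ i → defect (vertex i) j))
        ≡⟨ cong (λ z → + n ℤ.* ℤ.1ℤ ℤ.+ z) (sum-cong-≗ {k} (λ j →
             sum-indicator setoid |G|≡n {λ _ → ℤ.- + 2} (λ _ → ≡.refl) (T j))) ⟩
      + n ℤ.* ℤ.1ℤ ℤ.+ sum {k} (λ _ → ℤ.- + 2)
        ≡⟨ cong (λ z → + n ℤ.* ℤ.1ℤ ℤ.+ z) (sum-const k (ℤ.- + 2)) ⟩
      + n ℤ.* ℤ.1ℤ ℤ.+ + k ℤ.* (ℤ.- + 2)
        ≡⟨ eq (+ n) (+ k) ⟩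
      + n - + 2 ℤ.* + k
        ∎
      where
      open ≡.≡-Reasoning
      eq : ∀ n k → n ℤ.* ℤ.1ℤ ℤ.+ k ℤ.* (ℤ.- + 2) ≡ n - + 2 ℤ.* k
      eq = solve-∀

  signed-domination-number : SignedDominationNumberIs Γ (+ n - + 2 ℤ.* + (n / 3))
  signed-domination-number =
    (every-third position (n / 3) n/3*3≤n , every-third-dominating position (n / 3) n/3*3≤n ,
     every-third-weight position (n / 3) n/3*3≤n)
    , weight-lower-bound
    where
    position = proj₂ cycle-structure
    n/3*3≤n  = ℕ.m/n*n≤m n 3

-- The groups with signed domination number n - 4

SignedDominationNumber-unique : ∀ {a ℓ r} (Γ : FiniteSimpleGraph a ℓ r) {k l} →
  SignedDominationNumberIs Γ k → SignedDominationNumberIs Γ l → k ≡ l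
SignedDominationNumber-unique Γ ((g , g-dom , ≡.refl) , k-min) ((h , h-dom , ≡.refl) , l-min) =
  ℤ.≤-antisym (k-min h h-dom) (l-min g g-dom)

module _ {G : Group c ℓ} where
  -- In the dihedral case n = 2d forces d = 3 or d = 4 and excludes the odd order 7; for d = 3 the
  -- group is exchanged for S₃.
  cycle-group-of-order-6-7-8 : ∀ {n} → n ≡ 6 ⊎ n ≡ 7 ⊎ n ≡ 8 → CycleGroup G n →
    G ≅ ℤ/ 6 ⊎ G ≅ ℤ/ 7 ⊎ G ≅ ℤ/ 8 ⊎ G ≅ Symmetric-group 3 ⊎ G ≅ Dihedral 4
  cycle-group-of-order-6-7-8 (inj₁ ≡.refl)        (inj₁ iso) = inj₁ iso
  cycle-group-of-order-6-7-8 (inj₂ (inj₁ ≡.refl)) (inj₁ iso) = inj₂ (inj₁ iso)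
  cycle-group-of-order-6-7-8 (inj₂ (inj₂ ≡.refl)) (inj₁ iso) = inj₂ (inj₂ (inj₁ iso))
  cycle-group-of-order-6-7-8 (inj₁ ≡.refl)        (inj₂ (3 , _ , iso)) =
    inj₂ (inj₂ (inj₂ (inj₁ (≅-trans {G = G} {H = Dihedral 3} {K = Symmetric-group 3} iso
      (≅-sym {G = Symmetric-group 3} {H = Dihedral 3} S₃≅Dihedral₃)))))
  cycle-group-of-order-6-7-8 (inj₂ (inj₂ ≡.refl)) (inj₂ (4 , _ , iso)) = inj₂ (inj₂ (inj₂ (inj₂ iso)))
  cycle-group-of-order-6-7-8 (inj₁ ≡.refl)        (inj₂ (suc (suc (suc (suc _))) , () , _))
  cycle-group-of-order-6-7-8 (inj₂ (inj₁ ≡.refl)) (inj₂ (suc (suc (suc (suc _))) , () , _))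
  cycle-group-of-order-6-7-8 (inj₂ (inj₂ ≡.refl)) (inj₂ (suc (suc (suc (suc (suc _)))) , () , _))

  -- An isomorphism fixes the order of G, and 6, 7 and 8 all have quotient 2 by 3. The order of S₃
  -- is taken from `Dihedral 3`, which avoids counting permutations.
  n/3≡2 : G ≅ ℤ/ 6 ⊎ G ≅ ℤ/ 7 ⊎ G ≅ ℤ/ 8 ⊎ G ≅ Symmetric-group 3 ⊎ G ≅ Dihedral 4 →
    ∀ {n} → Group.setoid G HasCardinality n → n / 3 ≡ 2
  n/3≡2 isos {n} |G|≡n = by-order isos
    where
    order : ∀ {c′ ℓ′} {H : Group c′ ℓ′} {m} → G ≅ H → Group.setoid H HasCardinality m → m / 3 ≡ 2 → n / 3 ≡ 2
    order {H = H} iso |H|≡m = ≡.subst (λ k → k / 3 ≡ 2)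
      (HasCardinality-unique (≅-cardinality {G = G} {H = H} iso |H|≡m) |G|≡n)

    by-order : _ → n / 3 ≡ 2
    by-order (inj₁ iso)                      = order {H = ℤ/ 6} iso (ℤ/-cardinality 6) ≡.refl
    by-order (inj₂ (inj₁ iso))               = order {H = ℤ/ 7} iso (ℤ/-cardinality 7) ≡.refl
    by-order (inj₂ (inj₂ (inj₁ iso)))        = order {H = ℤ/ 8} iso (ℤ/-cardinality 8) ≡.refl
    by-order (inj₂ (inj₂ (inj₂ (inj₁ iso)))) = order {H = Symmetric-group 3} iso
      (≅-cardinality {G = Symmetric-group 3} {H = Dihedral 3} S₃≅Dihedral₃ (Dihedral-cardinality 3)) ≡.refl
    by-order (inj₂ (inj₂ (inj₂ (inj₂ iso)))) = order {H = Dihedral 4} iso (Dihedral-cardinality 4) ≡.refl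

theorem3p9 : ∀ {c ℓ p : Level} (G : Group c ℓ) (let open Group G hiding (_-_)) (n : ℕ) (|G|≡n : setoid HasCardinality n)
    (S : Pred Carrier p) (S-resp : S Respects _≈_) (ε∉S : ε ∉ S) (S≐S⁻¹ : S ≐ InverseSet G S)
    → Generates G S
    → (|S|≡2 : Subsetoid setoid S HasCardinality 2)
    → SignedDominationNumberIs (Cay G S S-resp |G|≡n |S|≡2 ε∉S S≐S⁻¹) (+ n - + 4)
      ⇔ (G ≅ ℤ/ 6 ⊎ G ≅ ℤ/ 7 ⊎ G ≅ ℤ/ 8 ⊎ G ≅ Symmetric-group 3 ⊎ G ≅ Dihedral 4)
theorem3p9 G n |G|≡n S S-resp ε∉S S≐S⁻¹ generates |S|≡2 = mk⇔
  (λ γ≡n-4 → cycle-group-of-order-6-7-8 {G = G}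
    (n/3≡2⇒6≤n≤8 n (n-2q≡n-4⇒q≡2 n (n / 3)
      (SignedDominationNumber-unique Γ signed-domination-number γ≡n-4)))
    (proj₁ cycle-structure))
  (λ isos → ≡.subst (λ q → SignedDominationNumberIs Γ (+ n - + 2 ℤ.* + q)) (n/3≡2 {G = G} isos |G|≡n)
    signed-domination-number)
  where open CayleyCycle G |G|≡n S S-resp ε∉S S≐S⁻¹ generates |S|≡2
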